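{- The variety of semilinear commutative idempotent residuated lattices has the amalgamation property.
   Context: A commutative residuated lattice is an algebra $\mathbf A=\langle A,\wedge,\vee,\cdot,\to,\mathrm e\rangle$ such that $\langle A,\wedge,\vee\rangle$ is a lattice, $\langle A,\cdot,\mathrm e\rangle$ is a commutative monoid, and $ab\le c\iff b\le a\to c$ for all $a,b,c\in A$. It is idempotent if $aa=a$ for all $a$. The variety of semilinear commutative idempotent residuated lattices is the variety generated by all totally ordered commutative idempotent residuated lattices. A class $\mathsf K$ of algebras has the amalgamation property if for all $\mathbf A,\mathbf B,\mathbf C\in\mathsf K$ and embeddings $i_1\colon\mathbf A\to\mathbf B$, $i_2\colon\mathbf A\to\mathbf C$, there exist $\mathbf D\in\mathsf K$ and embeddings $j_1\colon\mathbf B\to\mathbf D$, $j_2\colon\mathbf C\to\mathbf D$ with $j_1\circ i_1=j_2\circ i_2$. -}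

module Defs where

open import Level using (Level; 0ℓ) renaming (suc to lsuc)
open import Data.Nat.Base using (ℕ)
open import Data.Product.Base using (_×_; _,_; Σ-syntax)
open import Function.Bundles using (_⇔_)
open import Relation.Unary using (Pred; _∈_; _⊆_)
open import Relation.Binary.Core using (Rel)
open import Relation.Binary.Definitions using (Total)
open import Relation.Binary.Structures using (IsEquivalence)
open import Relation.Binary.Morphism.Structures using (IsRelMonomorphism)
open import Algebra.Core using (Op₂)
open import Algebra.Definitions using (Congruent₂; Idempotent)
open import Algebra.Structures using (IsCommutativeMonoid)
open import Algebra.Lattice.Structures using (IsLattice)
open import Algebra.Morphism.Definitions using (Homomorphic₀; Homomorphic₂)

infix 4 _⊨_

-- Algebras of the signature ⟨∧, ∨, ·, →, e⟩, with no laws imposed.  The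
-- residual a → b is written a ⇒ b.  Carriers are setoids, so equality of
-- elements is _≈_ and the operations are required to respect it.

record Algebra (ℓ : Level) : Set (lsuc ℓ) where
  infix  4 _≈_
  infixr 5 _⇒_
  infixr 6 _∨_
  infixr 7 _∧_
  infixl 8 _·_
  field
    Carrier       : Set ℓ
    _≈_           : Rel Carrier ℓ
    _∧_ _∨_ _·_ _⇒_ : Op₂ Carrier
    e             : Carrier
    isEquivalence : IsEquivalence _≈_
    ∧-cong        : Congruent₂ _≈_ _∧_
    ∨-cong        : Congruent₂ _≈_ _∨_
    ·-cong        : Congruent₂ _≈_ _·_
    ⇒-cong        : Congruent₂ _≈_ _⇒_

  infix 4 _≤_
  _≤_ : Rel Carrier ℓ
  a ≤ b = a ∧ b ≈ a

record IsCommutativeResiduatedLattice {ℓ} (𝐀 : Algebra ℓ) : Set ℓ where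
  open Algebra 𝐀
  field
    isLattice           : IsLattice _≈_ _∨_ _∧_
    isCommutativeMonoid : IsCommutativeMonoid _≈_ _·_ e
    residuation         : ∀ a b c → (a · b ≤ c) ⇔ (b ≤ a ⇒ c)

record IsTotallyOrderedCommutativeIdempotentResiduatedLattice
         {ℓ} (𝐀 : Algebra ℓ) : Set ℓ where
  open Algebra 𝐀
  field
    isCommutativeResiduatedLattice : IsCommutativeResiduatedLattice 𝐀
    idempotent                     : Idempotent _≈_ _·_
    total                          : Total _≤_

data Term : Set where
  var                     : ℕ → Term
  _∧ᵗ_ _∨ᵗ_ _·ᵗ_ _⇒ᵗ_ : Term → Term → Term
  eᵗ                      : Term

module _ {ℓ} (𝐀 : Algebra ℓ) where
  open Algebra 𝐀

  eval : (ℕ → Carrier) → Term → Carrier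
  eval ρ (var n)  = ρ n
  eval ρ (s ∧ᵗ t) = eval ρ s ∧ eval ρ t
  eval ρ (s ∨ᵗ t) = eval ρ s ∨ eval ρ t
  eval ρ (s ·ᵗ t) = eval ρ s · eval ρ t
  eval ρ (s ⇒ᵗ t) = eval ρ s ⇒ eval ρ t
  eval ρ eᵗ       = e

Identity : Set
Identity = Term × Term

_⊨_ : ∀ {ℓ} → Algebra ℓ → Identity → Set ℓ
𝐀 ⊨ (s , t) = ∀ ρ → eval 𝐀 ρ s ≈ eval 𝐀 ρ t
  where open Algebra 𝐀

-- A variety is a class of algebras of the form Mod E for a set E of
-- identities.

Mod : ∀ {ℓ} → Pred Identity 0ℓ → Pred (Algebra ℓ) ℓ
Mod E 𝐀 = ∀ {i} → i ∈ E → 𝐀 ⊨ i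

-- The variety generated by K is the least variety containing K, that is,
-- the intersection of all varieties containing K.

VarietyGeneratedBy : ∀ {ℓ k} → Pred (Algebra ℓ) k → Pred (Algebra ℓ) _
VarietyGeneratedBy K 𝐀 = ∀ (E : Pred Identity 0ℓ) → K ⊆ Mod E → 𝐀 ∈ Mod E

SemilinearCommutativeIdempotentResiduatedLattice :
  ∀ {ℓ} → Pred (Algebra ℓ) (lsuc ℓ)
SemilinearCommutativeIdempotentResiduatedLattice =
  VarietyGeneratedBy IsTotallyOrderedCommutativeIdempotentResiduatedLattice

record Embedding {ℓ} (𝐀 𝐁 : Algebra ℓ) : Set ℓ where
  private
    module A = Algebra 𝐀
    module B = Algebra 𝐁
  field
    ⟦_⟧               : A.Carrier → B.Carrier
    isRelMonomorphism : IsRelMonomorphism A._≈_ B._≈_ ⟦_⟧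
    ∧-homo            : Homomorphic₂ A.Carrier B.Carrier B._≈_ ⟦_⟧ A._∧_ B._∧_
    ∨-homo            : Homomorphic₂ A.Carrier B.Carrier B._≈_ ⟦_⟧ A._∨_ B._∨_
    ·-homo            : Homomorphic₂ A.Carrier B.Carrier B._≈_ ⟦_⟧ A._·_ B._·_
    ⇒-homo            : Homomorphic₂ A.Carrier B.Carrier B._≈_ ⟦_⟧ A._⇒_ B._⇒_
    e-homo            : Homomorphic₀ A.Carrier B.Carrier B._≈_ ⟦_⟧ A.e B.e

  open IsRelMonomorphism isRelMonomorphism public using (cong; injective)

AmalgamationProperty : ∀ {ℓ k} → Pred (Algebra ℓ) k → Set _
AmalgamationProperty {ℓ} K =
  ∀ (𝐀 𝐁 𝐂 : Algebra ℓ) → 𝐀 ∈ K → 𝐁 ∈ K → 𝐂 ∈ K →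
  (i₁ : Embedding 𝐀 𝐁) (i₂ : Embedding 𝐀 𝐂) →
  Σ[ 𝐃 ∈ Algebra ℓ ] 𝐃 ∈ K ×
  (Σ[ j₁ ∈ Embedding 𝐁 𝐃 ] Σ[ j₂ ∈ Embedding 𝐂 𝐃 ]
    (∀ a → Algebra._≈_ 𝐃 (Embedding.⟦_⟧ j₁ (Embedding.⟦_⟧ i₁ a))
                         (Embedding.⟦_⟧ j₂ (Embedding.⟦_⟧ i₂ a))))

{-# OPTIONS --safe #-}

-- A commutative idempotent residuated chain is determined by its order and the
-- antitone Galois connection x * = x ⇒ e: x · y is the minimum of x and y if x ≤ y *
-- and their maximum otherwise.  Every finitely generated such chain is a homomorphic
-- image of a subalgebra of one decidable chain 𝐔 on ℤ × ℕ, and finite pieces of 𝐔 are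
-- amalgamated explicitly inside 𝐔.  Instead of prime filters, the amalgam 𝐃 of B and C
-- over A is the algebra of terms over B ⊎ C, modulo the equations that finitely many
-- facts about A, B and C entail under valuations in 𝐔.  Conservativity over B is shown
-- by interpolation.  The facts about C used in a derivation imply a finite disjunction W,
-- in the variables shared with A, of the diagrams of their models in 𝐔.  Then e ≤ W
-- holds in C, hence in A and in B; and in 𝐔, quotients of models of the facts about B
-- and of W amalgamate with models of the facts about C.

module Submission where

open import Defs

open import Level using (Level; 0ℓ) renaming (suc to lsuc)
open import Data.Nat.Base using (ℕ; zero; suc)
import Data.Nat.Base as ℕ
import Data.Nat.Properties as ℕ
open import Data.Integer.Base using (ℤ; +_; -[1+_]; +[1+_]; 0ℤ; -_; ∣_∣)
import Data.Integer.Base as ℤ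
import Data.Integer.Properties as ℤ
open import Data.Sign.Base using (Sign; opposite) renaming (+ to ⊕; - to ⊖)
open import Data.Fin.Base using (Fin; zero; suc; toℕ; fromℕ<)
import Data.Fin.Properties as Fin
open import Data.Unit.Base using (⊤; tt)
open import Data.Product.Base using (_×_; _,_; proj₁; proj₂; Σ-syntax)
open import Data.Sum.Base using (_⊎_; inj₁; inj₂; [_,_]′)
import Data.Sum.Base as Sum
open import Data.List.Base
  using (List; []; _∷_; [_]; _++_; map; foldr; filter; length; upTo; allFin; cartesianProductWith)
open import Data.List.Properties using (length-tabulate)
import Data.List.Extrema as Extrema
open import Data.List.Relation.Unary.All using (All; []; _∷_)
import Data.List.Relation.Unary.All as All
import Data.List.Relation.Unary.All.Properties as All
open import Data.List.Relation.Unary.Any using (here; there)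
open import Data.List.Relation.Unary.AllPairs using (AllPairs; []; _∷_)
open import Data.List.Membership.Propositional using () renaming (_∈_ to _∈ˡ_)
open import Data.List.Membership.Propositional.Properties
  using (∈-cartesianProductWith⁺; ∈-cartesianProductWith⁻; ∈-map⁺; ∈-++⁺ˡ; ∈-++⁺ʳ; ∈-upTo⁺; ∈-allFin;
         ∈-filter⁺; ∈-filter⁻)
open import Function.Base using (_∘_)
open import Function.Bundles using (Equivalence; _⇔_; mk⇔)
open import Relation.Nullary using (¬_; Dec; yes; no; contradiction; _×-dec_)
open import Relation.Unary using (Pred; Decidable; _∈_)
open import Relation.Binary.Core using (Rel)
open import Relation.Binary.Bundles using (TotalOrder)
open import Relation.Binary.Definitions using (tri<; tri≈; tri>)
open import Relation.Binary.Structures using (IsEquivalence; IsDecTotalOrder)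
import Relation.Binary.Lattice as OrderLattice
open import Relation.Binary.PropositionalEquality
  using (_≡_; refl; sym; trans; cong; cong₂; subst; subst₂)
  renaming (isEquivalence to ≡-isEquivalence)
open import Algebra.Core using (Op₂)
open import Algebra.Structures using (IsCommutativeMonoid)
open import Algebra.Lattice.Structures using (IsLattice)
open import Algebra.Lattice.Bundles using (Lattice)
import Algebra.Lattice.Properties.Lattice as LatticeProperties
import Algebra.Construct.NaturalChoice.Min as Min
import Algebra.Construct.NaturalChoice.Max as Max
import Algebra.Lattice.Construct.NaturalChoice.MinMaxOp as MinMax

-- Commutative idempotent residuated chains

-- Membership in the variety provides identities and nothing else, so every implication about `𝐁`
-- has to be recast as an identity. Premises are gathered into a term `G ≤ e`; the implication from
-- `G ≈ e` to `x ≈ y` then follows from the identity `x · G ≈ y · G`, which is tested in `𝐔` on the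
-- quotient by the filter that `G` generates. The same kind of quotient turns an arbitrary valuation
-- into a model of given facts, so the interpolant can range over all valuations in a finite box
-- without any of them being selected. Order and equality in an arbitrary chain are not decidable,
-- and totality is the only source of decisions. Strictness is therefore weakened to a relation that
-- still allows both sides to be `e`, and a passage to a quotient has to be allowed when a chain is
-- represented in `𝐔`.

IsChain : ∀ {ℓ} → Algebra ℓ → Set ℓ
IsChain = IsTotallyOrderedCommutativeIdempotentResiduatedLattice

module Chain {ℓ} {𝐋 : Algebra ℓ} (chain : IsChain 𝐋) where
  open Algebra 𝐋 public
  open IsTotallyOrderedCommutativeIdempotentResiduatedLattice chain public
    renaming (idempotent to ·-idem)
  open IsCommutativeResiduatedLattice isCommutativeResiduatedLattice public
  open IsEquivalence isEquivalence public renaming (refl to ≈-refl; sym to ≈-sym; trans to ≈-trans; reflexive to ≈-reflexive)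
  open IsCommutativeMonoid isCommutativeMonoid using ()
    renaming (comm to ·-comm; assoc to ·-assoc; identityˡ to ·-identityˡ; identityʳ to ·-identityʳ) public

  private
    lattice : Lattice ℓ ℓ
    lattice = record { isLattice = isLattice }
    module O = OrderLattice.Lattice (LatticeProperties.∨-∧-orderTheoreticLattice lattice)

  open IsLattice isLattice public using (∧-comm; ∨-comm)

  infix 9 _*
  _* : Carrier → Carrier
  x * = x ⇒ e

  *-cong : ∀ {x y} → x ≈ y → x * ≈ y *
  *-cong x≈y = ⇒-cong x≈y ≈-refl

  ≤-reflexive : ∀ {x y} → x ≈ y → x ≤ y
  ≤-reflexive x≈y = ≈-sym (O.reflexive x≈y)

  ≤-refl : ∀ {x} → x ≤ x
  ≤-refl = ≤-reflexive ≈-refl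

  ≤-trans : ∀ {x y z} → x ≤ y → y ≤ z → x ≤ z
  ≤-trans p q = ≈-sym (O.trans (≈-sym p) (≈-sym q))

  ≤-antisym : ∀ {x y} → x ≤ y → y ≤ x → x ≈ y
  ≤-antisym p q = O.antisym (≈-sym p) (≈-sym q)

  ≤-resp : ∀ {x y z w} → x ≈ y → z ≈ w → x ≤ z → y ≤ w
  ≤-resp p q r = ≤-trans (≤-reflexive (≈-sym p)) (≤-trans r (≤-reflexive q))

  x∧y≤x : ∀ x y → x ∧ y ≤ x
  x∧y≤x x y = ≈-sym (O.x∧y≤x x y)

  x∧y≤y : ∀ x y → x ∧ y ≤ y
  x∧y≤y x y = ≈-sym (O.x∧y≤y x y)

  ∧-greatest : ∀ {x y z} → z ≤ x → z ≤ y → z ≤ x ∧ y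
  ∧-greatest p q = ≈-sym (O.∧-greatest (≈-sym p) (≈-sym q))

  x≤x∨y : ∀ x y → x ≤ x ∨ y
  x≤x∨y x y = ≈-sym (O.x≤x∨y x y)

  y≤x∨y : ∀ x y → y ≤ x ∨ y
  y≤x∨y x y = ≈-sym (O.y≤x∨y x y)

  ∨-least : ∀ {x y z} → x ≤ z → y ≤ z → x ∨ y ≤ z
  ∨-least p q = ≈-sym (O.∨-least (≈-sym p) (≈-sym q))

  x≤y⇒x∨y≈y : ∀ {x y} → x ≤ y → x ∨ y ≈ y
  x≤y⇒x∨y≈y {x} {y} p = ≤-antisym (∨-least p ≤-refl) (y≤x∨y x y)

  y≤x⇒x∨y≈x : ∀ {x y} → y ≤ x → x ∨ y ≈ x
  y≤x⇒x∨y≈x {x} {y} p = ≈-trans (∨-comm x y) (x≤y⇒x∨y≈y p)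

  y≤x⇒x∧y≈y : ∀ {x y} → y ≤ x → x ∧ y ≈ y
  y≤x⇒x∧y≈y {x} {y} p = ≈-trans (∧-comm x y) p

  res : ∀ {x y z} → x · y ≤ z → y ≤ x ⇒ z
  res {x} {y} {z} = Equivalence.to (residuation x y z)

  unres : ∀ {x y z} → y ≤ x ⇒ z → x · y ≤ z
  unres {x} {y} {z} = Equivalence.from (residuation x y z)

  ·-monoʳ : ∀ x {y z} → y ≤ z → x · y ≤ x · z
  ·-monoʳ x p = unres (≤-trans p (res ≤-refl))

  ·-monoˡ : ∀ {x y} z → x ≤ y → x · z ≤ y · z
  ·-monoˡ {x} {y} z p = ≤-resp (·-comm z x) (·-comm z y) (·-monoʳ z p)

  ·-mono : ∀ {x y z w} → x ≤ y → z ≤ w → x · z ≤ y · w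
  ·-mono {y = y} {z} p q = ≤-trans (·-monoˡ z p) (·-monoʳ y q)

  ·-≤-self : ∀ {x y z} → x ≤ z → y ≤ z → x · y ≤ z
  ·-≤-self p q = ≤-trans (·-mono p q) (≤-reflexive (·-idem _))

  e≤⇒ : ∀ {x y} → x ≤ y → e ≤ x ⇒ y
  e≤⇒ {x} p = res (≤-trans (≤-reflexive (·-identityʳ x)) p)

  e≤⇒⁻ : ∀ {x y} → e ≤ x ⇒ y → x ≤ y
  e≤⇒⁻ {x} p = ≤-trans (≤-reflexive (≈-sym (·-identityʳ x))) (unres p)

  x·x*≤e : ∀ x → x · x * ≤ e
  x·x*≤e x = unres ≤-refl

  ≤*-sym : ∀ {x y} → x ≤ y * → y ≤ x *
  ≤*-sym {x} {y} p = res (≤-trans (≤-reflexive (·-comm x y)) (unres p))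

  x≤x** : ∀ x → x ≤ x * *
  x≤x** x = ≤*-sym ≤-refl

  *-antitone : ∀ {x y} → x ≤ y → y * ≤ x *
  *-antitone p = ≤*-sym (≤-trans p (x≤x** _))

  x***≈x* : ∀ x → x * * * ≈ x *
  x***≈x* x = ≤-antisym (*-antitone (x≤x** x)) (x≤x** (x *))

  e*≈e : e * ≈ e
  e*≈e = ≤-antisym (≤-trans (≤-reflexive (≈-sym (·-identityˡ (e *)))) (x·x*≤e e))
                   (e≤⇒ ≤-refl)

  ≤e⇒e≤* : ∀ {x} → x ≤ e → e ≤ x *
  ≤e⇒e≤* p = ≤-trans (≤-reflexive (≈-sym e*≈e)) (*-antitone p)

  e≤⇒*≤e : ∀ {x} → e ≤ x → x * ≤ e
  e≤⇒*≤e p = ≤-trans (*-antitone p) (≤-reflexive e*≈e)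

  -- Idempotence squeezes the product: `x · y ≈ x · (x · y)` is at most `x · e`, and `x ≈ x · x` is
  -- at most `x · y`.
  ·-conservative≤ : ∀ {x y} → x ≤ y → x · y ≤ e → x · y ≈ x
  ·-conservative≤ {x} {y} x≤y xy≤e = ≤-antisym
    (≤-trans (≤-reflexive (≈-sym (≈-trans (≈-sym (·-assoc x x y)) (·-cong (·-idem x) ≈-refl))))
      (≤-trans (·-monoʳ x xy≤e) (≤-reflexive (·-identityʳ x))))
    (≤-trans (≤-reflexive (≈-sym (·-idem x))) (·-monoʳ x x≤y))

  ·≈∧ : ∀ {x y} → x · y ≤ e → x · y ≈ x ∧ y
  ·≈∧ {x} {y} p with total x y
  ... | inj₁ x≤y = ≈-trans (·-conservative≤ x≤y p) (≈-sym x≤y)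
  ... | inj₂ y≤x = ≈-trans (·-comm x y)
        (≈-trans (·-conservative≤ y≤x (≤-resp (·-comm x y) ≈-refl p)) (≈-sym (y≤x⇒x∧y≈y y≤x)))

  ·-conservative≥ : ∀ {x y} → x ≤ y → e ≤ x · y → x · y ≈ y
  ·-conservative≥ {x} {y} x≤y e≤xy = ≤-antisym
    (·-≤-self x≤y ≤-refl)
    (≤-trans (≤-reflexive (≈-sym (·-identityˡ y)))
      (≤-trans (·-monoˡ y e≤xy)
        (≤-reflexive (≈-trans (·-assoc x y y) (·-cong ≈-refl (·-idem y))))))

  ·≈∨ : ∀ {x y} → e ≤ x · y → x · y ≈ x ∨ y
  ·≈∨ {x} {y} p with total x y
  ... | inj₁ x≤y = ≈-trans (·-conservative≥ x≤y p) (≈-sym (x≤y⇒x∨y≈y x≤y))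
  ... | inj₂ y≤x = ≈-trans (·-comm x y)
        (≈-trans (·-conservative≥ y≤x (≤-resp ≈-refl (·-comm x y) p)) (≈-sym (y≤x⇒x∨y≈x y≤x)))

  -- For the upper bound, either `x · (x ⇒ z) ≤ e`, so that `x ⇒ z ≤ x *`, or the product is the
  -- join of its factors and bounds `x ⇒ z` by `z`.
  ⇒-of-≤ : ∀ {x z} → x ≤ z → x ⇒ z ≈ x * ∨ z
  ⇒-of-≤ {x} {z} x≤z = ≤-antisym upper
    (∨-least (res (≤-trans (≤-resp (≈-sym (·≈∧ (x·x*≤e x))) ≈-refl (x∧y≤x x (x *))) x≤z))
             (res (·-≤-self x≤z ≤-refl)))
    where
    upper : x ⇒ z ≤ x * ∨ z
    upper with total (x · (x ⇒ z)) e
    ... | inj₁ q = ≤-trans (res q) (x≤x∨y _ _)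
    ... | inj₂ q = ≤-trans (≤-trans (y≤x∨y x _) (≤-reflexive (≈-sym (·≈∨ q))))
                     (≤-trans (unres ≤-refl) (y≤x∨y _ _))

  -- A constructive substitute for x < y: a homomorphism of chains is strictly
  -- increasing except that it may collapse an interval around e.
  infix 4 _≺_
  _≺_ : Carrier → Carrier → Set ℓ
  x ≺ y = y ≤ x → x ≈ e × y ≈ e

  ≺⇒≤ : ∀ {x y} → x ≺ y → x ≤ y
  ≺⇒≤ {x} {y} p with total x y
  ... | inj₁ x≤y = x≤y
  ... | inj₂ y≤x = ≤-reflexive (≈-trans (proj₁ (p y≤x)) (≈-sym (proj₂ (p y≤x))))

  ≤-≺-≤ : ∀ {x y z w} → x ≤ y → y ≺ z → z ≤ w → x ≺ w
  ≤-≺-≤ {x} {y} {z} {w} p q r w≤x =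
    let z≤y = ≤-trans r (≤-trans w≤x p)
        y≈e , z≈e = q z≤y
    in ≤-antisym (≤-trans p (≤-reflexive y≈e))
         (≤-trans (≤-reflexive (≈-sym z≈e)) (≤-trans r w≤x))
     , ≤-antisym (≤-trans w≤x (≤-trans p (≤-reflexive y≈e)))
         (≤-trans (≤-reflexive (≈-sym z≈e)) r)

  ≺-resp : ∀ {x y z w} → x ≈ y → z ≈ w → x ≺ z → y ≺ w
  ≺-resp p q r = ≤-≺-≤ (≤-reflexive (≈-sym p)) r (≤-reflexive q)

  ≤e≤⇒≺ : ∀ {x y} → x ≤ e → e ≤ y → x ≺ y
  ≤e≤⇒≺ p q y≤x = ≤-antisym p (≤-trans q y≤x) , ≤-antisym (≤-trans y≤x p) q

  -- Any case that yields `x ≤ z` is degenerate: by `z ≺ x` both elements are then `e`, where both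
  -- sides equal `e`.
  ⇒-of-≻ : ∀ {x z} → z ≺ x → x ⇒ z ≈ x * ∧ z
  ⇒-of-≻ {x} {z} z≺x = ≤-antisym upper (res (≤-trans
      (≤-reflexive (·≈∧ (≤-trans (·-monoʳ x (x∧y≤x (x *) z)) (x·x*≤e x))))
      (≤-trans (x∧y≤y _ _) (x∧y≤y _ _))))
    where
    y = x ⇒ z
    collapsed : x ≤ z → y ≤ x * ∧ z
    collapsed x≤z = let z≈e , x≈e = z≺x x≤z in ≤-reflexive
      (≈-trans (⇒-cong x≈e z≈e) (≈-trans e*≈e
        (≈-sym (≈-trans (∧-cong (≈-trans (*-cong x≈e) e*≈e) z≈e) ≤-refl))))
    upper : y ≤ x * ∧ z
    upper with total (x · y) e
    ... | inj₂ q = collapsed (≤-trans (≤-trans (x≤x∨y x y) (≤-reflexive (≈-sym (·≈∨ q)))) (unres ≤-refl))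
    ... | inj₁ q with total x y
    ...   | inj₁ x≤y = collapsed (≤-trans (≤-reflexive (≈-sym (·-conservative≤ x≤y q))) (unres ≤-refl))
    ...   | inj₂ y≤x = ∧-greatest (res q)
              (≤-trans (≤-reflexive (≈-sym (≈-trans (·≈∧ q) (y≤x⇒x∧y≈y y≤x)))) (unres ≤-refl))

  -- If `x · y ≤ e`, then `x ≤ y *` and `y ≤ x *`; each hypothesis then makes one of the factors
  -- equal to `e`.
  *≺⇒·≈∨ : ∀ {x y} → y * ≺ x → x * ≺ y → x · y ≈ x ∨ y
  *≺⇒·≈∨ {x} {y} p q with total e (x · y)
  ... | inj₁ r = ·≈∨ r
  ... | inj₂ r = let y≤x* = res r
                     x≈e = proj₂ (p (≤*-sym y≤x*))
                     y≈e = proj₂ (q y≤x*)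
                 in ·≈∨ (≤-reflexive (≈-sym (≈-trans (·-cong x≈e y≈e) (·-identityˡ e))))

  ≤*⇒·≈∧ : ∀ {x y} → x ≤ y * → x · y ≈ x ∧ y
  ≤*⇒·≈∧ {x} {y} p = ·≈∧ (≤-trans (≤-reflexive (·-comm x y)) (unres p))

  -- The decision is read off from the residual `y ⇒ x`, not from `x` and `y` themselves. Two
  -- outcomes of totality give `y ≤ y · (y ⇒ x) ≤ x`. In the third, `y ⇒ x` is below both `x` and
  -- `y *`, so `y ≤ x`, which means `e ≤ y ⇒ x`, forces `x` and `y` to be `e`.
  ≤⇒≈⊎≺ : ∀ {x y} → x ≤ y → x ≈ y ⊎ x ≺ y
  ≤⇒≈⊎≺ {x} {y} x≤y with total (y · (y ⇒ x)) e
  ... | inj₂ q = inj₁ (≤-antisym x≤y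
          (≤-trans (≤-trans (x≤x∨y y _) (≤-reflexive (≈-sym (·≈∨ q)))) (unres ≤-refl)))
  ... | inj₁ q with total y (y ⇒ x)
  ...   | inj₁ r = inj₁ (≤-antisym x≤y (≤-trans (≤-reflexive (≈-sym (·-conservative≤ r q))) (unres ≤-refl)))
  ...   | inj₂ r = inj₂ λ y≤x →
            let e≤y⇒x = e≤⇒ y≤x
                e≤x = ≤-trans e≤y⇒x (≤-trans (≤-reflexive (≈-sym (≈-trans (·≈∧ q) (y≤x⇒x∧y≈y r)))) (unres ≤-refl))
                y≤e = ≤-trans (≤*-sym (≤-trans e≤y⇒x (res q))) (≤-reflexive e*≈e)
            in ≤-antisym (≤-trans x≤y y≤e) e≤x , ≤-antisym y≤e (≤-trans e≤x x≤y)

-- In a chain every operation is determined by comparisons and _*, so a relation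
-- between two chains that respects these is a subalgebra of their product.
record Correspondence {ℓ} {𝐌 𝐋 : Algebra ℓ} (M : IsChain 𝐌) (L : IsChain 𝐋) : Set (lsuc ℓ) where
  private
    module M = Chain M
    module L = Chain L
  field
    R       : M.Carrier → L.Carrier → Set ℓ
    R-resp  : ∀ {u u′ l l′} → u M.≈ u′ → l L.≈ l′ → R u l → R u′ l′
    R-e     : R M.e L.e
    R-*     : ∀ {u l} → R u l → R (u M.*) (l L.*)
    compare : ∀ {u l u′ l′} → R u l → R u′ l′ →
              (u M.≤ u′ × l L.≤ l′) ⊎ (u′ M.≺ u × l′ L.≺ l)

  R-∧ : ∀ {u l u′ l′} → R u l → R u′ l′ → R (u M.∧ u′) (l L.∧ l′)
  R-∧ r r′ with compare r r′
  ... | inj₁ (p , q) = R-resp (M.≈-sym p) (L.≈-sym q) r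
  ... | inj₂ (p , q) = R-resp (M.≈-sym (M.y≤x⇒x∧y≈y (M.≺⇒≤ p))) (L.≈-sym (L.y≤x⇒x∧y≈y (L.≺⇒≤ q))) r′

  R-∨ : ∀ {u l u′ l′} → R u l → R u′ l′ → R (u M.∨ u′) (l L.∨ l′)
  R-∨ r r′ with compare r r′
  ... | inj₁ (p , q) = R-resp (M.≈-sym (M.x≤y⇒x∨y≈y p)) (L.≈-sym (L.x≤y⇒x∨y≈y q)) r′
  ... | inj₂ (p , q) = R-resp (M.≈-sym (M.y≤x⇒x∨y≈x (M.≺⇒≤ p))) (L.≈-sym (L.y≤x⇒x∨y≈x (L.≺⇒≤ q))) r

  R-· : ∀ {u l u′ l′} → R u l → R u′ l′ → R (u M.· u′) (l L.· l′)
  R-· r r′ with compare r (R-* r′) | compare r′ (R-* r)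
  ... | inj₁ (p , q) | _ = R-resp (M.≈-sym (M.≤*⇒·≈∧ p)) (L.≈-sym (L.≤*⇒·≈∧ q)) (R-∧ r r′)
  ... | inj₂ _ | inj₁ (p , q) = R-resp (M.≈-sym (M.≤*⇒·≈∧ (M.≤*-sym p))) (L.≈-sym (L.≤*⇒·≈∧ (L.≤*-sym q))) (R-∧ r r′)
  ... | inj₂ (p , q) | inj₂ (p′ , q′) =
        R-resp (M.≈-sym (M.*≺⇒·≈∨ p p′)) (L.≈-sym (L.*≺⇒·≈∨ q q′)) (R-∨ r r′)

  R-⇒ : ∀ {u l u′ l′} → R u l → R u′ l′ → R (u M.⇒ u′) (l L.⇒ l′)
  R-⇒ r r′ with compare r r′
  ... | inj₁ (p , q) = R-resp (M.≈-sym (M.⇒-of-≤ p)) (L.≈-sym (L.⇒-of-≤ q)) (R-∨ (R-* r) r′)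
  ... | inj₂ (p , q) = R-resp (M.≈-sym (M.⇒-of-≻ p)) (L.≈-sym (L.⇒-of-≻ q)) (R-∧ (R-* r) r′)

-- The universal chain

-- Every decidable total order with an antitone Galois self-connection fixing e
-- carries exactly one structure of commutative idempotent residuated chain with x * = x ⇒ e.
module GaloisChain {ℓ} {A : Set ℓ} {_≼_ : Rel A 0ℓ} (O : IsDecTotalOrder _≡_ _≼_)
  (_⋆ : A → A) (ε : A) (ε⋆ : ε ⋆ ≡ ε) (galois : ∀ {x y} → x ≼ (y ⋆) → y ≼ (x ⋆)) where

  private
    module O = IsDecTotalOrder O
    order : TotalOrder ℓ ℓ 0ℓ
    order = record { isTotalOrder = O.isTotalOrder }

    open Min order using (_⊓_; minOperator; x⊓y≈x⇒x≤y; x≤y⇒x⊓y≈x; x≤y⇒y⊓x≈x; x⊓y≤x; x⊓y≤y; ⊓-glb)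
    open Max order using (_⊔_; maxOperator; x≤y⇒x⊔y≈y; x≤y⇒y⊔x≈y; x≤x⊔y; x≤y⊔x; ⊔-lub; ⊔-sel)

    _⊥_ : Rel A 0ℓ
    x ⊥ y = x ≼ (y ⋆)

    ⊥-monoˡ : ∀ {x y z} → x ≼ y → y ⊥ z → x ⊥ z
    ⊥-monoˡ = O.trans

    ⊥-monoʳ : ∀ {x y z} → x ≼ y → z ⊥ y → z ⊥ x
    ⊥-monoʳ p q = galois (O.trans p (galois q))

    -- x ⊑ y stands for x · y ≡ x, so that the product is the meet for ⊑.
    data _⊑_ (x y : A) : Set where
      low  : x ⊥ y → x ≼ y → x ⊑ y
      high : ¬ (x ⊥ y) → y ≼ x → x ⊑ y

    ⊑-refl : ∀ {x y} → x ≡ y → x ⊑ y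
    ⊑-refl {x} refl with x O.≤? (x ⋆)
    ... | yes p = low p O.refl
    ... | no p  = high p O.refl

    ≰⇒≽ : ∀ {x y} → ¬ (x ≼ y) → y ≼ x
    ≰⇒≽ {x} {y} p = [ (λ q → contradiction q p) , (λ q → q) ]′ (O.total x y)

    -- In the mixed cases the comparison of the outer elements is forced, because `⊥` is inherited
    -- downwards in both arguments.
    ⊑-trans : ∀ {x y z} → x ⊑ y → y ⊑ z → x ⊑ z
    ⊑-trans (low p q) (low r s) = low (⊥-monoˡ q r) (O.trans q s)
    ⊑-trans {x} {y} {z} (low p q) (high r s) with z O.≤? x
    ... | yes t = contradiction (galois (⊥-monoˡ t p)) r
    ... | no t  = low (⊥-monoʳ s p) (≰⇒≽ t)
    ⊑-trans {x} {y} {z} (high p q) (low r s) with x O.≤? z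
    ... | yes t = contradiction (galois (⊥-monoʳ t r)) p
    ... | no t  = high (λ u → p (⊥-monoʳ s u)) (≰⇒≽ t)
    ⊑-trans (high p q) (high r s) = high (λ u → r (⊥-monoˡ q u)) (O.trans s q)

    ⊑-antisym : ∀ {x y} → x ⊑ y → y ⊑ x → x ≡ y
    ⊑-antisym (low p q) (low r s) = O.antisym q s
    ⊑-antisym (low p q) (high r s) = contradiction (galois p) r
    ⊑-antisym (high p q) (low r s) = contradiction (galois r) p
    ⊑-antisym (high p q) (high r s) = O.antisym s q

    abstract
      ⊑-total : ∀ x y → x ⊑ y ⊎ y ⊑ x
      ⊑-total x y with x O.≤? (y ⋆) | O.total x y
      ... | yes p | inj₁ q = inj₁ (low p q)
      ... | yes p | inj₂ q = inj₂ (low (galois p) q)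
      ... | no p  | inj₁ q = inj₂ (high (λ r → p (galois r)) q)
      ... | no p  | inj₂ q = inj₁ (high p q)

    ⊑-order : TotalOrder ℓ ℓ 0ℓ
    ⊑-order = record { isTotalOrder = record
      { isPartialOrder = record
        { isPreorder = record { isEquivalence = ≡-isEquivalence ; reflexive = ⊑-refl ; trans = ⊑-trans }
        ; antisym = ⊑-antisym }
      ; total = ⊑-total } }

    module P = Min ⊑-order

    ·≡⊓ : ∀ {x y} → x ⊥ y → x P.⊓ y ≡ x ⊓ y
    ·≡⊓ {x} {y} p = [ (λ q → trans (P.x≤y⇒x⊓y≈x (low p q)) (sym (x≤y⇒x⊓y≈x q)))
                    , (λ q → trans (P.x≤y⇒y⊓x≈x (low (galois p) q)) (sym (x≤y⇒y⊓x≈x q))) ]′ (O.total x y)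

    ·≡⊔ : ∀ {x y} → ¬ (x ⊥ y) → x P.⊓ y ≡ x ⊔ y
    ·≡⊔ {x} {y} p = [ (λ q → trans (P.x≤y⇒y⊓x≈x (high (λ r → p (galois r)) q)) (sym (x≤y⇒x⊔y≈y q)))
                    , (λ q → trans (P.x≤y⇒x⊓y≈x (high p q)) (sym (x≤y⇒y⊔x≈y q))) ]′ (O.total x y)

    -- The values found in `⇒-of-≤` and `⇒-of-≻`, usable as a definition because this order is
    -- decidable.
    imp : A → A → A
    imp a c with a O.≤? c
    ... | yes _ = (a ⋆) ⊔ c
    ... | no _  = (a ⋆) ⊓ c

    residuate : ∀ a b c → (a P.⊓ b) ≼ c → b ≼ imp a c
    residuate a b c p with a O.≤? c | a O.≤? (b ⋆)
    ... | yes q | yes r = O.trans (galois r) (x≤x⊔y (a ⋆) c)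
    ... | yes q | no r  = O.trans (x≤y⊔x a b) (O.trans (subst (_≼ c) (·≡⊔ r) p) (x≤y⊔x (a ⋆) c))
    ... | no q  | yes r = ⊓-glb (galois r) (subst (_≼ c) (trans (·≡⊓ r) (x≤y⇒y⊓x≈x b≼a)) p)
      where
      b≼a : b ≼ a
      b≼a with O.total a b
      ... | inj₂ s = s
      ... | inj₁ s = contradiction (subst (_≼ c) (trans (·≡⊓ r) (x≤y⇒x⊓y≈x s)) p) q
    ... | no q  | no r  = contradiction (O.trans (x≤x⊔y a b) (subst (_≼ c) (·≡⊔ r) p)) q

    unresiduate : ∀ a b c → b ≼ imp a c → (a P.⊓ b) ≼ c
    unresiduate a b c p with a O.≤? c | a O.≤? (b ⋆)
    ... | yes q | yes r = subst (_≼ c) (sym (·≡⊓ r)) (O.trans (x⊓y≤x a b) q)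
    ... | yes q | no r with ⊔-sel (a ⋆) c
    ...   | inj₁ s = contradiction (galois (subst (b ≼_) s p)) r
    ...   | inj₂ s = subst (_≼ c) (sym (·≡⊔ r)) (⊔-lub q (subst (b ≼_) s p))
    unresiduate a b c p | no q | yes r = subst (_≼ c) (sym (·≡⊓ r)) (O.trans (x⊓y≤y a b) (O.trans p (x⊓y≤y (a ⋆) c)))
    unresiduate a b c p | no q | no r  = contradiction (galois (O.trans p (x⊓y≤x (a ⋆) c))) r

    identityʳ : ∀ x → x P.⊓ ε ≡ x
    identityʳ x with x O.≤? (ε ⋆)
    ... | yes p = P.x≤y⇒x⊓y≈x (low p (subst (x ≼_) ε⋆ p))
    ... | no p  = P.x≤y⇒x⊓y≈x (high p (≰⇒≽ λ q → p (subst (x ≼_) (sym ε⋆) q)))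

  abstract
    meet join prod resid : A → A → A
    meet = _⊓_
    join = _⊔_
    prod = P._⊓_
    resid = imp

    isLattice : IsLattice _≡_ join meet
    isLattice = MinMax.⊔-⊓-isLattice minOperator maxOperator

    isCommutativeMonoid : IsCommutativeMonoid _≡_ prod ε
    isCommutativeMonoid = record
      { isMonoid = record
        { isSemigroup = P.⊓-isSemigroup
        ; identity = (λ x → trans (P.⊓-comm ε x) (identityʳ x)) , identityʳ }
      ; comm = P.⊓-comm }

    prod-idem : ∀ x → prod x x ≡ x
    prod-idem = P.⊓-idem

    ≼⇒≤ : ∀ {x y} → x ≼ y → meet x y ≡ x
    ≼⇒≤ = x≤y⇒x⊓y≈x

    ≤⇒≼ : ∀ {x y} → meet x y ≡ x → x ≼ y
    ≤⇒≼ = x⊓y≈x⇒x≤y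

    residuation : ∀ a b c → (meet (prod a b) c ≡ prod a b) ⇔ (meet b (resid a c) ≡ b)
    residuation a b c = mk⇔ (λ p → ≼⇒≤ (residuate a b c (≤⇒≼ p)))
                            (λ p → ≼⇒≤ (unresiduate a b c (≤⇒≼ p)))

    resid-ε : ∀ x → resid x ε ≡ x ⋆
    resid-ε x with x O.≤? ε
    ... | yes p = x≤y⇒y⊔x≈y (galois (subst (x ≼_) (sym ε⋆) p))
    ... | no p  = x≤y⇒x⊓y≈x (subst ((x ⋆) ≼_) ε⋆ (galois (O.trans (≰⇒≽ p) (galois O.refl))))

  algebra : Algebra ℓ
  algebra = record
    { Carrier = A ; _≈_ = _≡_ ; _∧_ = meet ; _∨_ = join ; _·_ = prod ; _⇒_ = resid ; e = ε
    ; isEquivalence = ≡-isEquivalence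
    ; ∧-cong = cong₂ meet ; ∨-cong = cong₂ join ; ·-cong = cong₂ prod ; ⇒-cong = cong₂ resid }

  isChain : IsChain algebra
  isChain = record
    { isCommutativeResiduatedLattice = record
      { isLattice = isLattice ; isCommutativeMonoid = isCommutativeMonoid ; residuation = residuation }
    ; idempotent = prod-idem
    ; total = λ x y → [ (λ p → inj₁ (≼⇒≤ p)) , (λ p → inj₂ (≼⇒≤ p)) ]′ (O.total x y) }

-- (z , j) is the element at depth j of block z: blocks are ordered as in ℤ, each of
-- them downwards from its top (z , 0), and (z , j) ⋆ = (- z , 0).
record U (ℓ : Level) : Set ℓ where
  constructor _,_
  field
    block : ℤ
    depth : ℕ
open U

module _ {ℓ : Level} where

  infix 4 _≼_ _≺≺_
  data _≼_ : Rel (U ℓ) 0ℓ where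
    block< : ∀ {z w j k} → z ℤ.< w → (z , j) ≼ (w , k)
    depth≤ : ∀ {z j k} → k ℕ.≤ j → (z , j) ≼ (z , k)

  data _≺≺_ : Rel (U ℓ) 0ℓ where
    block< : ∀ {z w j k} → z ℤ.< w → (z , j) ≺≺ (w , k)
    depth< : ∀ {z j k} → k ℕ.< j → (z , j) ≺≺ (z , k)

  ≼-reflexive : ∀ {x y} → x ≡ y → x ≼ y
  ≼-reflexive refl = depth≤ ℕ.≤-refl

  ≼-trans : ∀ {x y z} → x ≼ y → y ≼ z → x ≼ z
  ≼-trans (block< p) (block< q) = block< (ℤ.<-trans p q)
  ≼-trans (block< p) (depth≤ q) = block< p
  ≼-trans (depth≤ p) (block< q) = block< q
  ≼-trans (depth≤ p) (depth≤ q) = depth≤ (ℕ.≤-trans q p)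

  ≼-antisym : ∀ {x y} → x ≼ y → y ≼ x → x ≡ y
  ≼-antisym (block< p) (block< q) = contradiction q (ℤ.<-asym p)
  ≼-antisym (block< p) (depth≤ _) = contradiction p (ℤ.<-irrefl refl)
  ≼-antisym (depth≤ _) (block< q) = contradiction q (ℤ.<-irrefl refl)
  ≼-antisym (depth≤ p) (depth≤ q) = cong (_ ,_) (ℕ.≤-antisym q p)

  ≼⊎≻≻ : ∀ x y → x ≼ y ⊎ y ≺≺ x
  ≼⊎≻≻ (z , j) (w , k) with ℤ.<-cmp z w
  ... | tri< p _ _ = inj₁ (block< p)
  ... | tri> _ _ p = inj₂ (block< p)
  ... | tri≈ _ refl _ with ℕ.≤-<-connex k j
  ...   | inj₁ q = inj₁ (depth≤ q)
  ...   | inj₂ q = inj₂ (depth< q)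

  ≺≺⇒≼ : ∀ {x y} → x ≺≺ y → x ≼ y
  ≺≺⇒≼ (block< p) = block< p
  ≺≺⇒≼ (depth< p) = depth≤ (ℕ.<⇒≤ p)

  ≺≺⇒⋡ : ∀ {x y} → x ≺≺ y → ¬ (y ≼ x)
  ≺≺⇒⋡ (block< p) (block< q) = ℤ.<-asym p q
  ≺≺⇒⋡ (block< p) (depth≤ q) = ℤ.<-irrefl refl p
  ≺≺⇒⋡ (depth< p) (block< q) = ℤ.<-irrefl refl q
  ≺≺⇒⋡ (depth< p) (depth≤ q) = ℕ.<⇒≱ p q

  _≼?_ : ∀ x y → Dec (x ≼ y)
  x ≼? y = [ yes , (λ p → no (≺≺⇒⋡ p)) ]′ (≼⊎≻≻ x y)

  ≼-total : ∀ x y → x ≼ y ⊎ y ≼ x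
  ≼-total x y = [ inj₁ , (λ p → inj₂ (≺≺⇒≼ p)) ]′ (≼⊎≻≻ x y)

  _≟ᵁ_ : ∀ (x y : U ℓ) → Dec (x ≡ y)
  x ≟ᵁ y with x ≼? y | y ≼? x
  ... | yes p | yes q = yes (≼-antisym p q)
  ... | no p  | _     = no λ { refl → p (≼-reflexive refl) }
  ... | _     | no q  = no λ { refl → q (≼-reflexive refl) }

  ≼-isDecTotalOrder : IsDecTotalOrder _≡_ _≼_
  ≼-isDecTotalOrder = record
    { isTotalOrder = record
      { isPartialOrder = record
        { isPreorder = record { isEquivalence = ≡-isEquivalence ; reflexive = ≼-reflexive ; trans = ≼-trans }
        ; antisym = ≼-antisym }
      ; total = ≼-total }
    ; _≟_ = _≟ᵁ_ ; _≤?_ = _≼?_ }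

  ≼-totalOrder : TotalOrder ℓ ℓ 0ℓ
  ≼-totalOrder = record { isTotalOrder = IsDecTotalOrder.isTotalOrder ≼-isDecTotalOrder }

  _⋆ : U ℓ → U ℓ
  (z , _) ⋆ = - z , 0

  ≼⋆ : ∀ {z j w} → z ℤ.≤ w → (z , j) ≼ (w , 0)
  ≼⋆ {z} {j} {w} p with ℤ.<-cmp z w
  ... | tri< q _ _ = block< q
  ... | tri≈ _ refl _ = depth≤ ℕ.z≤n
  ... | tri> _ _ q = contradiction p (ℤ.<⇒≱ q)

  ≼⇒block≤ : ∀ {x y} → x ≼ y → block x ℤ.≤ block y
  ≼⇒block≤ (block< p) = ℤ.<⇒≤ p
  ≼⇒block≤ (depth≤ p) = ℤ.≤-refl

  ⋆-galois : ∀ {x y} → x ≼ (y ⋆) → y ≼ (x ⋆)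
  ⋆-galois {x} {y} p = ≼⋆ (subst (ℤ._≤ (- block x)) (ℤ.neg-involutive (block y)) (ℤ.neg-mono-≤ (≼⇒block≤ p)))

  open GaloisChain ≼-isDecTotalOrder _⋆ (0ℤ , 0) refl ⋆-galois public
    renaming (algebra to 𝐔; isChain to 𝐔-isChain; resid-ε to *≡⋆)
    using (≼⇒≤; ≤⇒≼)

-- Terms and diagrams

bound : Term → ℕ
bound (var i)  = suc i
bound (s ∧ᵗ t) = bound s ℕ.⊔ bound t
bound (s ∨ᵗ t) = bound s ℕ.⊔ bound t
bound (s ·ᵗ t) = bound s ℕ.⊔ bound t
bound (s ⇒ᵗ t) = bound s ℕ.⊔ bound t
bound eᵗ       = 0

sub : (ℕ → Term) → Term → Term
sub θ (var i)  = θ i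
sub θ (s ∧ᵗ t) = sub θ s ∧ᵗ sub θ t
sub θ (s ∨ᵗ t) = sub θ s ∨ᵗ sub θ t
sub θ (s ·ᵗ t) = sub θ s ·ᵗ sub θ t
sub θ (s ⇒ᵗ t) = sub θ s ⇒ᵗ sub θ t
sub θ eᵗ       = eᵗ

bound-sub : ∀ {N θ} → (∀ k → bound (θ k) ℕ.≤ N) → ∀ t → bound (sub θ t) ℕ.≤ N
bound-sub p (var i)  = p i
bound-sub p (s ∧ᵗ t) = ℕ.⊔-lub (bound-sub p s) (bound-sub p t)
bound-sub p (s ∨ᵗ t) = ℕ.⊔-lub (bound-sub p s) (bound-sub p t)
bound-sub p (s ·ᵗ t) = ℕ.⊔-lub (bound-sub p s) (bound-sub p t)
bound-sub p (s ⇒ᵗ t) = ℕ.⊔-lub (bound-sub p s) (bound-sub p t)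
bound-sub p eᵗ       = ℕ.z≤n

module _ {ℓ} (𝐀 : Algebra ℓ) where
  open Algebra 𝐀

  eval-sub : ∀ θ ρ t → eval 𝐀 ρ (sub θ t) ≡ eval 𝐀 (λ i → eval 𝐀 ρ (θ i)) t
  eval-sub θ ρ (var i)  = refl
  eval-sub θ ρ (s ∧ᵗ t) = cong₂ _∧_ (eval-sub θ ρ s) (eval-sub θ ρ t)
  eval-sub θ ρ (s ∨ᵗ t) = cong₂ _∨_ (eval-sub θ ρ s) (eval-sub θ ρ t)
  eval-sub θ ρ (s ·ᵗ t) = cong₂ _·_ (eval-sub θ ρ s) (eval-sub θ ρ t)
  eval-sub θ ρ (s ⇒ᵗ t) = cong₂ _⇒_ (eval-sub θ ρ s) (eval-sub θ ρ t)
  eval-sub θ ρ eᵗ       = refl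

  eval-cong : ∀ {ρ σ} → (∀ i → ρ i ≈ σ i) → ∀ t → eval 𝐀 ρ t ≈ eval 𝐀 σ t
  eval-cong p (var i)  = p i
  eval-cong p (s ∧ᵗ t) = ∧-cong (eval-cong p s) (eval-cong p t)
  eval-cong p (s ∨ᵗ t) = ∨-cong (eval-cong p s) (eval-cong p t)
  eval-cong p (s ·ᵗ t) = ·-cong (eval-cong p s) (eval-cong p t)
  eval-cong p (s ⇒ᵗ t) = ⇒-cong (eval-cong p s) (eval-cong p t)
  eval-cong p eᵗ       = IsEquivalence.refl isEquivalence

module _ {ℓ} {𝐀 𝐁 : Algebra ℓ} (i : Embedding 𝐀 𝐁) where
  private
    open module E = Embedding i using (⟦_⟧)
    open module B = Algebra 𝐁 using (_≈_)
    open IsEquivalence B.isEquivalence using () renaming (refl to ≈-refl; trans to ≈-trans)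

  eval-embedding : ∀ α t → ⟦ eval 𝐀 α t ⟧ ≈ eval 𝐁 (λ k → ⟦ α k ⟧) t
  eval-embedding α (var k)  = ≈-refl
  eval-embedding α (s ∧ᵗ t) = ≈-trans (E.∧-homo _ _) (B.∧-cong (eval-embedding α s) (eval-embedding α t))
  eval-embedding α (s ∨ᵗ t) = ≈-trans (E.∨-homo _ _) (B.∨-cong (eval-embedding α s) (eval-embedding α t))
  eval-embedding α (s ·ᵗ t) = ≈-trans (E.·-homo _ _) (B.·-cong (eval-embedding α s) (eval-embedding α t))
  eval-embedding α (s ⇒ᵗ t) = ≈-trans (E.⇒-homo _ _) (B.⇒-cong (eval-embedding α s) (eval-embedding α t))
  eval-embedding α eᵗ       = E.e-homo

module _ {ℓ} {𝐌 𝐋 : Algebra ℓ} {M : IsChain 𝐌} {L : IsChain 𝐋} (C : Correspondence M L) where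
  open Correspondence C

  R-eval : ∀ {v ρ} t → (∀ i → i ℕ.< bound t → R (v i) (ρ i)) → R (eval 𝐌 v t) (eval 𝐋 ρ t)
  R-eval (var i)  p = p i ℕ.≤-refl
  R-eval (s ∧ᵗ t) p = R-∧ (R-eval s λ i q → p i (ℕ.m<n⇒m<n⊔o (bound t) q)) (R-eval t λ i q → p i (ℕ.m<n⇒m<o⊔n (bound s) q))
  R-eval (s ∨ᵗ t) p = R-∨ (R-eval s λ i q → p i (ℕ.m<n⇒m<n⊔o (bound t) q)) (R-eval t λ i q → p i (ℕ.m<n⇒m<o⊔n (bound s) q))
  R-eval (s ·ᵗ t) p = R-· (R-eval s λ i q → p i (ℕ.m<n⇒m<n⊔o (bound t) q)) (R-eval t λ i q → p i (ℕ.m<n⇒m<o⊔n (bound s) q))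
  R-eval (s ⇒ᵗ t) p = R-⇒ (R-eval s λ i q → p i (ℕ.m<n⇒m<n⊔o (bound t) q)) (R-eval t λ i q → p i (ℕ.m<n⇒m<o⊔n (bound s) q))
  R-eval eᵗ       p = R-e

infix 30 _*ᵗ
_*ᵗ : Term → Term
t *ᵗ = t ⇒ᵗ eᵗ

⋀ : List Term → Term
⋀ = foldr _∧ᵗ_ eᵗ

module _ {ℓ : Level} where
  private module 𝒰 = Chain (𝐔-isChain {ℓ})

  𝐞 : U ℓ
  𝐞 = 𝒰.e

  ≺≺⇒≺ : ∀ {x y : U ℓ} → x ≺≺ y → x 𝒰.≺ y
  ≺≺⇒≺ p q = contradiction (≤⇒≼ q) (≺≺⇒⋡ p)

  -- These are homomorphisms whose only identifications happen at `e`; by `Correspondence`,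
  -- preserving `e`, `⋆` and the order is enough.
  record NearEmbedding (φ : U ℓ → U ℓ) : Set ℓ where
    field
      φ-e : φ 𝐞 ≡ 𝐞
      φ-⋆ : ∀ x → φ (x ⋆) ≡ φ x ⋆
      φ-≺ : ∀ {x y} → x ≺≺ y → φ x 𝒰.≺ φ y

    φ-mono : ∀ {x y} → x ≼ y → φ x ≼ φ y
    φ-mono {x} {y} p with ≼⊎≻≻ y x
    ... | inj₁ q = ≼-reflexive (cong φ (≼-antisym p q))
    ... | inj₂ q = ≤⇒≼ (𝒰.≺⇒≤ (φ-≺ q))

    correspondence : Correspondence 𝐔-isChain 𝐔-isChain
    correspondence = record
      { R = λ u l → φ u ≡ l
      ; R-resp = λ { refl refl r → r }
      ; R-e = φ-e
      ; R-* = λ { {u} refl → trans (cong φ (*≡⋆ u)) (trans (φ-⋆ u) (sym (*≡⋆ (φ u)))) }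
      ; compare = λ { {u} {_} {u′} refl refl →
          [ (λ p → inj₁ (≼⇒≤ p , ≼⇒≤ (φ-mono p))) , (λ p → inj₂ (≺≺⇒≺ p , φ-≺ p)) ]′ (≼⊎≻≻ u u′) } }

    eval-φ : ∀ v t → φ (eval 𝐔 v t) ≡ eval 𝐔 (λ i → φ (v i)) t
    eval-φ v t = R-eval correspondence t λ _ _ → refl

  e≤⋀⁺ : ∀ {v ts} → All (λ t → 𝐞 𝒰.≤ eval 𝐔 v t) ts → 𝐞 𝒰.≤ eval 𝐔 v (⋀ ts)
  e≤⋀⁺ []       = 𝒰.≤-refl
  e≤⋀⁺ (p ∷ ps) = 𝒰.∧-greatest p (e≤⋀⁺ ps)

  e≤⋀⁻ : ∀ {v} ts → 𝐞 𝒰.≤ eval 𝐔 v (⋀ ts) → All (λ t → 𝐞 𝒰.≤ eval 𝐔 v t) ts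
  e≤⋀⁻ []       p = []
  e≤⋀⁻ (t ∷ ts) p = 𝒰.≤-trans p (𝒰.x∧y≤x _ _) ∷ e≤⋀⁻ ts (𝒰.≤-trans p (𝒰.x∧y≤y _ _))

-- Since `x * * * ≈ x *`, and in a chain the other operations select among their arguments and
-- images under `*`, the values of these labels form the whole subalgebra generated by the first `m`
-- variables.
labels : ℕ → List Term
labels zero    = eᵗ ∷ []
labels (suc m) = var m ∷ var m *ᵗ ∷ var m *ᵗ *ᵗ ∷ labels m


e∈labels : ∀ m → eᵗ ∈ˡ labels m
e∈labels zero    = here refl
e∈labels (suc m) = there (there (there (e∈labels m)))

var∈labels : ∀ {m k} → k ℕ.< m →
  var k ∈ˡ labels m × var k *ᵗ ∈ˡ labels m × var k *ᵗ *ᵗ ∈ˡ labels m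
var∈labels {suc m} {k} (ℕ.s≤s k≤m) with ℕ.m≤n⇒m<n∨m≡n k≤m
... | inj₂ refl = here refl , there (here refl) , there (there (here refl))
... | inj₁ k<m  = let p , q , r = var∈labels k<m in
      there (there (there p)) , there (there (there q)) , there (there (there r))

module _ {ℓ : Level} where
  private module 𝒰 = Chain (𝐔-isChain {ℓ})

  *∈labels : ∀ {a} m → a ∈ˡ labels m → Σ[ b ∈ Term ] b ∈ˡ labels m ×
    (∀ (v : ℕ → U ℓ) → eval 𝐔 v b ≡ eval 𝐔 v a 𝒰.*)
  *∈labels zero    (here refl) = eᵗ , here refl , λ v → sym 𝒰.e*≈e
  *∈labels (suc m) (here refl) = _ , there (here refl) , λ v → refl
  *∈labels (suc m) (there (here refl)) = _ , there (there (here refl)) , λ v → refl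
  *∈labels (suc m) (there (there (here refl))) = _ , there (here refl) , λ v → sym (𝒰.x***≈x* _)
  *∈labels (suc m) (there (there (there p))) =
    let b , q , r = *∈labels m p in b , there (there (there q)) , r

  -- The second form expresses b ≺ a.
  atom : (ℕ → U ℓ) → Term → Term → Term
  atom q a b with eval 𝐔 q a ≼? eval 𝐔 q b
  ... | yes _ = a ⇒ᵗ b
  ... | no _  = ((a ⇒ᵗ b) ⇒ᵗ (a *ᵗ ∧ᵗ b)) ∧ᵗ (b ⇒ᵗ a)

  diag : ℕ → (ℕ → U ℓ) → Term
  diag m q = ⋀ (cartesianProductWith (atom q) (labels m) (labels m))

  atom-self : ∀ q a b → 𝐞 𝒰.≤ eval 𝐔 q (atom q a b)
  atom-self q a b with eval 𝐔 q a ≼? eval 𝐔 q b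
  ... | yes p = 𝒰.e≤⇒ (≼⇒≤ p)
  ... | no p with ≼⊎≻≻ (eval 𝐔 q a) (eval 𝐔 q b)
  ...   | inj₁ r = contradiction r p
  ...   | inj₂ r = 𝒰.∧-greatest (𝒰.e≤⇒ (𝒰.≤-reflexive (𝒰.⇒-of-≻ (≺≺⇒≺ r)))) (𝒰.e≤⇒ (≼⇒≤ (≺≺⇒≼ r)))

  diag-self : ∀ m q → 𝐞 𝒰.≤ eval 𝐔 q (diag m q)
  diag-self m q = e≤⋀⁺ (All.tabulate λ r →
    let a , b , _ , _ , eq = ∈-cartesianProductWith⁻ (atom q) (labels m) (labels m) r
    in subst (λ t → 𝐞 𝒰.≤ eval 𝐔 q t) (sym eq) (atom-self q a b))

  -- This is what makes `q ↦ p` a homomorphism on the values of the labels: strict inequalities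
  -- survive unless both sides become `e`.
  record Specialises (m : ℕ) (q p : ℕ → U ℓ) : Set ℓ where
    field
      ≼-specialise : ∀ {a b} → a ∈ˡ labels m → b ∈ˡ labels m →
        eval 𝐔 q a ≼ eval 𝐔 q b → eval 𝐔 p a ≼ eval 𝐔 p b
      ≺-specialise : ∀ {a b} → a ∈ˡ labels m → b ∈ˡ labels m →
        eval 𝐔 q a ≺≺ eval 𝐔 q b → eval 𝐔 p a 𝒰.≺ eval 𝐔 p b

  atom-≼ : ∀ {q p} a b → 𝐞 𝒰.≤ eval 𝐔 p (atom q a b) →
    eval 𝐔 q a ≼ eval 𝐔 q b → eval 𝐔 p a ≼ eval 𝐔 p b
  atom-≼ {q} a b r s with eval 𝐔 q a ≼? eval 𝐔 q b
  ... | yes _ = ≤⇒≼ (𝒰.e≤⇒⁻ r)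
  ... | no t  = contradiction s t

  -- The first conjunct is `⇒-of-≻` read backwards: `b ≤ a` gives `e ≤ b ⇒ a`, hence `e ≤ b *` and
  -- `e ≤ a`, and with `a ≤ b` both are `e`.
  atom-≺ : ∀ {q p} a b → 𝐞 𝒰.≤ eval 𝐔 p (atom q b a) →
    eval 𝐔 q a ≺≺ eval 𝐔 q b → eval 𝐔 p a 𝒰.≺ eval 𝐔 p b
  atom-≺ {q} a b r s b≤a with eval 𝐔 q b ≼? eval 𝐔 q a
  ... | yes t = contradiction t (≺≺⇒⋡ s)
  ... | no _  =
    let a≤b = 𝒰.e≤⇒⁻ (𝒰.≤-trans r (𝒰.x∧y≤y _ _))
        e≤b*∧a = 𝒰.≤-trans (𝒰.e≤⇒ b≤a) (𝒰.e≤⇒⁻ (𝒰.≤-trans r (𝒰.x∧y≤x _ _)))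
        e≤a = 𝒰.≤-trans e≤b*∧a (𝒰.x∧y≤y _ _)
        b≤e = 𝒰.≤-trans (𝒰.≤*-sym (𝒰.≤-trans e≤b*∧a (𝒰.x∧y≤x _ _))) (𝒰.≤-reflexive 𝒰.e*≈e)
    in 𝒰.≤-antisym (𝒰.≤-trans a≤b b≤e) e≤a , 𝒰.≤-antisym b≤e (𝒰.≤-trans e≤a a≤b)

  diag⇒specialises : ∀ {m q p} → 𝐞 𝒰.≤ eval 𝐔 p (diag m q) → Specialises m q p
  diag⇒specialises {m} {q} {p} r = record
    { ≼-specialise = λ {a} {b} a∈ b∈ → atom-≼ {q} {p} a b (All.lookup all (∈-cartesianProductWith⁺ (atom q) a∈ b∈))
    ; ≺-specialise = λ {a} {b} a∈ b∈ → atom-≺ {q} {p} a b (All.lookup all (∈-cartesianProductWith⁺ (atom q) b∈ a∈)) }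
    where all = e≤⋀⁻ (cartesianProductWith (atom q) (labels m) (labels m)) r

-- Every finitely generated chain is an image of a subalgebra of the universal chain

-- Ranking along a total preorder: strictness is only decided between neighbours
-- of a sorted list, since pairwise decisions need not be coherent.
module Ranking {ℓ} {I : Set} {_⊴_ _∼_ _◁_ : Rel I ℓ}
  (⊴-total : ∀ i j → i ⊴ j ⊎ j ⊴ i) (⊴-trans : ∀ {i j k} → i ⊴ j → j ⊴ k → i ⊴ k)
  (∼-refl : ∀ {i} → i ∼ i) (∼-sym : ∀ {i j} → i ∼ j → j ∼ i) (∼-trans : ∀ {i j k} → i ∼ j → j ∼ k → i ∼ k)
  (⊴-◁-⊴ : ∀ {i j k l} → i ⊴ j → j ◁ k → k ⊴ l → i ◁ l)
  (decide : ∀ {i j} → i ⊴ j → i ∼ j ⊎ i ◁ j) where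

  private
    ⊴-refl : ∀ {i} → i ⊴ i
    ⊴-refl {i} = [ (λ p → p) , (λ p → p) ]′ (⊴-total i i)

    record Inserted (x : I) (xs : List I) : Set ℓ where
      field
        ys      : List I
        sorted  : AllPairs _⊴_ ys
        x∈ys    : x ∈ˡ ys
        xs⊆ys   : ∀ {z} → z ∈ˡ xs → z ∈ˡ ys
        ys⊆x∷xs : ∀ {z} → z ∈ˡ ys → z ≡ x ⊎ z ∈ˡ xs
        len     : length ys ≡ suc (length xs)

    insert : ∀ x {xs} → AllPairs _⊴_ xs → Inserted x xs
    insert x [] = record
      { ys = x ∷ [] ; sorted = [] ∷ [] ; x∈ys = here refl ; xs⊆ys = there
      ; ys⊆x∷xs = λ { (here p) → inj₁ p } ; len = refl }
    insert x {y ∷ xs} (y⊴ ∷ s) with ⊴-total x y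
    ... | inj₁ x⊴y = record
      { ys = x ∷ y ∷ xs ; sorted = (x⊴y ∷ All.map (⊴-trans x⊴y) y⊴) ∷ y⊴ ∷ s ; x∈ys = here refl
      ; xs⊆ys = there ; ys⊆x∷xs = λ { (here p) → inj₁ p ; (there p) → inj₂ p } ; len = refl }
    ... | inj₂ y⊴x = record
      { ys = y ∷ ys
      ; sorted = All.tabulate (λ p → [ (λ { refl → y⊴x }) , All.lookup y⊴ ]′ (ys⊆x∷xs p)) ∷ sorted
      ; x∈ys = there x∈ys
      ; xs⊆ys = λ { (here p) → here p ; (there p) → there (xs⊆ys p) }
      ; ys⊆x∷xs = λ { (here p) → inj₂ (here p) ; (there p) → Sum.map₂ there (ys⊆x∷xs p) }
      ; len = cong suc len }
      where open Inserted (insert x s)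

    sort : ∀ xs → Σ[ ys ∈ List I ] AllPairs _⊴_ ys × (∀ {z} → z ∈ˡ xs → z ∈ˡ ys) × length ys ≡ length xs
    sort [] = [] , [] , (λ p → p) , refl
    sort (x ∷ xs) with sort xs
    ... | ys , s , ⊆ , l = Inserted.ys i , Inserted.sorted i
        , (λ { (here refl) → Inserted.x∈ys i ; (there p) → Inserted.xs⊆ys i (⊆ p) })
        , trans (Inserted.len i) (cong suc l)
      where i = insert x s

    record Ranks (y : I) (ys : List I) : Set ℓ where
      field
        rk    : ∀ {z} → z ∈ˡ (y ∷ ys) → ℕ
        rk-y  : rk (here refl) ≡ 0
        rk-<  : ∀ {z w} (p : z ∈ˡ (y ∷ ys)) (q : w ∈ˡ (y ∷ ys)) → rk p ℕ.< rk q → z ◁ w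
        rk-≡  : ∀ {z w} (p : z ∈ˡ (y ∷ ys)) (q : w ∈ˡ (y ∷ ys)) → rk p ≡ rk q → z ∼ w
        rk-≤  : ∀ {z} (p : z ∈ˡ (y ∷ ys)) → rk p ℕ.≤ length ys

    -- A head strictly before its successor shifts all later ranks by one; a head equivalent to its
    -- successor shares rank 0 with it. All other comparisons follow through the successor.
    rank-sorted : ∀ y ys → AllPairs _⊴_ (y ∷ ys) → Ranks y ys
    rank-sorted y [] _ = record
      { rk = λ _ → 0 ; rk-y = refl ; rk-< = λ _ _ ()
      ; rk-≡ = λ { (here refl) (here refl) _ → ∼-refl } ; rk-≤ = λ _ → ℕ.z≤n }
    rank-sorted x (y ∷ ys) ((x⊴y ∷ _) ∷ s@(y⊴ ∷ _)) with decide x⊴y | rank-sorted y ys s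
    ... | inj₂ x◁y | r = record
      { rk = rk′ ; rk-y = refl ; rk-< = lt ; rk-≡ = eq
      ; rk-≤ = λ { (here refl) → ℕ.z≤n ; (there p) → ℕ.s≤s (rk-≤ p) } }
      where
      open Ranks r
      rk′ : ∀ {z} → z ∈ˡ (x ∷ y ∷ ys) → ℕ
      rk′ (here _)  = 0
      rk′ (there p) = suc (rk p)
      lt : ∀ {z w} (p : z ∈ˡ (x ∷ y ∷ ys)) (q : w ∈ˡ (x ∷ y ∷ ys)) → rk′ p ℕ.< rk′ q → z ◁ w
      lt (here refl) (there q) _ = ⊴-◁-⊴ ⊴-refl x◁y (All.lookup (⊴-refl ∷ y⊴) q)
      lt (there p) (there q) (ℕ.s≤s l) = rk-< p q l
      eq : ∀ {z w} (p : z ∈ˡ (x ∷ y ∷ ys)) (q : w ∈ˡ (x ∷ y ∷ ys)) → rk′ p ≡ rk′ q → z ∼ w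
      eq (here refl) (here refl) _ = ∼-refl
      eq (there p) (there q) l = rk-≡ p q (ℕ.suc-injective l)
    ... | inj₁ x∼y | r = record
      { rk = rk′ ; rk-y = refl ; rk-< = lt ; rk-≡ = eq
      ; rk-≤ = λ { (here refl) → ℕ.z≤n ; (there p) → ℕ.m≤n⇒m≤1+n (rk-≤ p) } }
      where
      open Ranks r
      rk′ : ∀ {z} → z ∈ˡ (x ∷ y ∷ ys) → ℕ
      rk′ (here _)  = 0
      rk′ (there p) = rk p
      lt : ∀ {z w} (p : z ∈ˡ (x ∷ y ∷ ys)) (q : w ∈ˡ (x ∷ y ∷ ys)) → rk′ p ℕ.< rk′ q → z ◁ w
      lt (here refl) (there q) l = ⊴-◁-⊴ x⊴y (rk-< (here refl) q (subst (ℕ._< rk q) (sym rk-y) l)) ⊴-refl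
      lt (there p) (there q) l = rk-< p q l
      eq : ∀ {z w} (p : z ∈ˡ (x ∷ y ∷ ys)) (q : w ∈ˡ (x ∷ y ∷ ys)) → rk′ p ≡ rk′ q → z ∼ w
      eq (here refl) (here refl) _ = ∼-refl
      eq (here refl) (there q) l = ∼-trans x∼y (rk-≡ (here refl) q (trans rk-y l))
      eq (there p) (here refl) l = ∼-sym (∼-trans x∼y (rk-≡ (here refl) p (trans rk-y (sym l))))
      eq (there p) (there q) l = rk-≡ p q l

  record RankFunction (xs : List I) : Set ℓ where
    field
      rank   : ∀ {i} → i ∈ˡ xs → ℕ
      rank-◁ : ∀ {i j} (p : i ∈ˡ xs) (q : j ∈ˡ xs) → rank p ℕ.< rank q → i ◁ j
      rank-∼ : ∀ {i j} (p : i ∈ˡ xs) (q : j ∈ˡ xs) → rank p ≡ rank q → i ∼ j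
      rank<  : ∀ {i} (p : i ∈ˡ xs) → rank p ℕ.< length xs

  abstract
    rankFunction : ∀ xs → RankFunction xs
    rankFunction xs with sort xs
    ... | [] , _ , ⊆ , _ = record
      { rank = λ _ → 0 ; rank-◁ = λ _ _ () ; rank-∼ = λ p → contradiction (⊆ p) λ () ; rank< = λ p → contradiction (⊆ p) λ () }
    ... | y ∷ ys , s , ⊆ , l = record
      { rank = λ p → rk (⊆ p) ; rank-◁ = λ p q → rk-< (⊆ p) (⊆ q) ; rank-∼ = λ p q → rk-≡ (⊆ p) (⊆ q)
      ; rank< = λ p → subst (rk (⊆ p) ℕ.<_) l (ℕ.s≤s (rk-≤ (⊆ p))) }
      where open Ranks (rank-sorted y ys s)

module _ {ℓ : Level} where
  private module 𝒰 = Chain (𝐔-isChain {ℓ})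

  -- With `b` generators the block and depth ranks are below `b` and get shifted by one, so `b`
  -- bounds every coordinate that a representation uses.
  box : ℕ → List (U ℓ)
  box b = cartesianProductWith _,_ (map +_ (upTo (suc b)) ++ map -[1+_] (upTo b)) (upTo (suc b))

  cons : U ℓ → (ℕ → U ℓ) → ℕ → U ℓ
  cons u v zero    = u
  cons u v (suc i) = v i

  valuations : ℕ → ℕ → List (ℕ → U ℓ)
  valuations b zero    = (λ _ → 𝒰.e) ∷ []
  valuations b (suc n) = cartesianProductWith cons (box b) (valuations b n)

  ∈-valuations : ∀ {b} n (f : Fin n → U ℓ) → (∀ i → f i ∈ˡ box b) →
    Σ[ v ∈ (ℕ → U ℓ) ] v ∈ˡ valuations b n × (∀ i → v (toℕ i) ≡ f i)
  ∈-valuations zero f p = _ , here refl , λ ()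
  ∈-valuations (suc n) f p with ∈-valuations n (λ i → f (suc i)) (λ i → p (suc i))
  ... | v , v∈ , eq = cons (f zero) v , ∈-cartesianProductWith⁺ cons (p zero) v∈
                    , λ { zero → refl ; (suc i) → eq i }

  ≺≺-inv : ∀ {x y : U ℓ} → x ≺≺ y →
    U.block x ℤ.< U.block y ⊎ U.block x ≡ U.block y × U.depth y ℕ.< U.depth x
  ≺≺-inv (block< p) = inj₁ p
  ≺≺-inv (depth< p) = inj₂ (refl , p)

module Representation {ℓ} {𝐋 : Algebra ℓ} (L : IsChain 𝐋) {N : ℕ}
  (x : Fin N → Algebra.Carrier 𝐋) where
  open Chain L
  private module 𝒰 = Chain (𝐔-isChain {ℓ})

  -- The block of x i is read off from y i, which is x i or x i *, whichever is ≤ e.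
  negative : (a : Carrier) → a ≤ e ⊎ e ≤ a → Carrier
  negative a (inj₁ _) = a
  negative a (inj₂ _) = a *

  sign : ∀ {a} → a ≤ e ⊎ e ≤ a → Sign
  sign (inj₁ _) = ⊖
  sign (inj₂ _) = ⊕

  y : Fin N → Carrier
  y i = negative (x i) (total (x i) e)

  s : Fin N → Sign
  s i = sign (total (x i) e)

  y≤e : ∀ i → y i ≤ e
  y≤e i with total (x i) e
  ... | inj₁ p = p
  ... | inj₂ p = e≤⇒*≤e p

  hullOf : Sign → Carrier → Carrier
  hullOf ⊖ a = a * *
  hullOf ⊕ a = a *

  closed : Sign → Fin N → Carrier
  closed σ i = hullOf σ (y i)

  x**≈closed : ∀ i → x i * * ≈ closed (s i) i
  x**≈closed i with total (x i) e
  ... | inj₁ _ = ≈-refl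
  ... | inj₂ _ = ≈-refl

  x*≈closed : ∀ i → x i * ≈ closed (opposite (s i)) i
  x*≈closed i with total (x i) e
  ... | inj₁ _ = ≈-refl
  ... | inj₂ _ = ≈-sym (x***≈x* _)

  -- Both rankings run downwards in the chain. For blocks, `i ∼ʸ j` says that `y i` and `y j` have
  -- the same closure, and `i ◁ʸ j` that even the top of the block of `y j` is strictly below `y i`.
  _⊴ʸ_ _∼ʸ_ _◁ʸ_ _⊴ˣ_ _∼ˣ_ _◁ˣ_ : Rel (Fin N) ℓ
  i ⊴ʸ j = y j ≤ y i
  i ∼ʸ j = y i * ≈ y j *
  i ◁ʸ j = y j * * ≺ y i
  i ⊴ˣ j = x j ≤ x i
  i ∼ˣ j = x i ≈ x j
  i ◁ˣ j = x j ≺ x i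

  -- An element between `y j` and its closure `y j * *` has the same image under `*` as `y j`;
  -- beyond the closure, `≤⇒≈⊎≺` decides.
  decideʸ : ∀ {i j} → i ⊴ʸ j → i ∼ʸ j ⊎ i ◁ʸ j
  decideʸ {i} {j} p = [ closer , farther ]′ (total (y j * *) (y i))
    where
    closer : y j * * ≤ y i → i ∼ʸ j ⊎ i ◁ʸ j
    closer q = Sum.map₁ (λ r → ≈-trans (*-cong (≈-sym r)) (x***≈x* (y j))) (≤⇒≈⊎≺ q)
    farther : y i ≤ y j * * → i ∼ʸ j ⊎ i ◁ʸ j
    farther q = inj₁ (≤-antisym (*-antitone p) (≤-resp (x***≈x* (y j)) ≈-refl (*-antitone q)))

  decideˣ : ∀ {i j} → i ⊴ˣ j → i ∼ˣ j ⊎ i ◁ˣ j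
  decideˣ p = Sum.map₁ ≈-sym (≤⇒≈⊎≺ p)

  ⊴-◁-⊴ʸ : ∀ {i j k l} → i ⊴ʸ j → j ◁ʸ k → k ⊴ʸ l → i ◁ʸ l
  ⊴-◁-⊴ʸ p q r = ≤-≺-≤ (*-antitone (*-antitone r)) q p

  ⊴-◁-⊴ˣ : ∀ {i j k l} → i ⊴ˣ j → j ◁ˣ k → k ⊴ˣ l → i ◁ˣ l
  ⊴-◁-⊴ˣ p q r = ≤-≺-≤ r q p

  module BlockRanking = Ranking {I = Fin N} {_⊴ʸ_} {_∼ʸ_} {_◁ʸ_}
    (λ i j → total (y j) (y i)) (λ p q → ≤-trans q p) ≈-refl ≈-sym ≈-trans ⊴-◁-⊴ʸ decideʸ

  module DepthRanking = Ranking {I = Fin N} {_⊴ˣ_} {_∼ˣ_} {_◁ˣ_}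
    (λ i j → total (x j) (x i)) (λ p q → ≤-trans q p) ≈-refl ≈-sym ≈-trans ⊴-◁-⊴ˣ decideˣ

  abstract
    private
      module B = BlockRanking.RankFunction (BlockRanking.rankFunction (allFin N))
      module D = DepthRanking.RankFunction (DepthRanking.rankFunction (allFin N))

      rank≤ : ∀ {k} → k ℕ.< length (allFin N) → k ℕ.< N
      rank≤ {k} = subst (k ℕ.<_) (length-tabulate {n = N} (λ i → i))

    blockRank depthRank : Fin N → ℕ
    blockRank i = B.rank (∈-allFin i)
    depthRank i = D.rank (∈-allFin i)

    blockRank-≺ : ∀ {i j} → blockRank i ℕ.< blockRank j → y j * * ≺ y i
    blockRank-≺ = B.rank-◁ (∈-allFin _) (∈-allFin _)

    blockRank-≈ : ∀ {i j} → blockRank i ≡ blockRank j → y i * ≈ y j *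
    blockRank-≈ = B.rank-∼ (∈-allFin _) (∈-allFin _)

    blockRank<N : ∀ i → blockRank i ℕ.< N
    blockRank<N i = rank≤ (B.rank< (∈-allFin i))

    depthRank-≺ : ∀ {i j} → depthRank i ℕ.< depthRank j → x j ≺ x i
    depthRank-≺ = D.rank-◁ (∈-allFin _) (∈-allFin _)

    depthRank-≈ : ∀ {i j} → depthRank i ≡ depthRank j → x i ≈ x j
    depthRank-≈ = D.rank-∼ (∈-allFin _) (∈-allFin _)

    depthRank<N : ∀ i → depthRank i ℕ.< N
    depthRank<N i = rank≤ (D.rank< (∈-allFin i))

  signed : Sign → ℕ → ℤ
  signed ⊖ k = -[1+ k ]
  signed ⊕ k = +[1+ k ]

  data Label : Set ℓ where
    unit : Label
    hull : Sign → Fin N → Label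
    gen  : (i : Fin N) → x i ≺ x i * * → Label

  -- Block 0 is reserved for `unit`. Whether a closed value equals `e` cannot be decided, so every
  -- generator gets a nonzero block, and `value` may send the top of that block to `e`. Depth 0
  -- belongs to the hull, hence the `suc`; one depth ranking of all generators serves every block.
  position : Label → U ℓ
  position unit       = 0ℤ , 0
  position (hull σ i) = signed σ (blockRank i) , 0
  position (gen i _)  = signed (s i) (blockRank i) , suc (depthRank i)

  value : Label → Carrier
  value unit       = e
  value (hull σ i) = closed σ i
  value (gen i _)  = x i

  data View (a : Label) : Set ℓ where
    isUnit : U.block (position a) ≡ 0ℤ → value a ≈ e → View a
    isNeg  : ∀ i → U.block (position a) ≡ -[1+ blockRank i ] →
             y i ≤ value a → value a ≤ y i * * → View a
    isPos  : ∀ i → U.block (position a) ≡ +[1+ blockRank i ] →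
             e ≤ value a → value a * ≈ y i * * → View a

  view : ∀ a → View a
  view unit       = isUnit refl ≈-refl
  view (hull ⊖ i) = isNeg i refl (x≤x** _) ≤-refl
  view (hull ⊕ i) = isPos i refl (≤e⇒e≤* (y≤e i)) ≈-refl
  view (gen i p)  = go (total (x i) e) refl
    where
    go : ∀ d → total (x i) e ≡ d → View (gen i p)
    go (inj₁ q) eq = isNeg i (cong (λ d → signed (sign d) (blockRank i)) eq)
      (≤-reflexive (≈-reflexive (cong (negative (x i)) eq)))
      (≤-trans (x≤x** _) (≤-reflexive (≈-reflexive (sym (cong (λ d → negative (x i) d * *) eq)))))
    go (inj₂ q) eq = isPos i (cong (λ d → signed (sign d) (blockRank i)) eq) q
      (≈-trans (≈-sym (x***≈x* _)) (≈-reflexive (sym (cong (λ d → negative (x i) d * *) eq))))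

  closed-≤e : ∀ i → y i * * ≤ e
  closed-≤e i = e≤⇒*≤e (≤e⇒e≤* (y≤e i))

  e≤a*⇒a≈e : ∀ {a} → e ≤ a → e ≤ a * → a ≈ e
  e≤a*⇒a≈e p q = ≤-antisym (≤-trans (≤*-sym q) (≤-reflexive e*≈e)) p

  -- Positive blocks are compared through `*`: from `b ≤ a` follows `y i ≤ a * ≤ b * ≈ y j * *`,
  -- which `blockRank-≺` permits only if `y i` and `y j * *` are `e`, and then so are `a` and `b`.
  positive-≺ : ∀ {a b i j} → blockRank i ℕ.< blockRank j → e ≤ a → a * ≈ y i * * → e ≤ b → b * ≈ y j * * → a ≺ b
  positive-≺ {a} {b} {i} {j} l e≤a a*≈ e≤b b*≈ b≤a = e≤a*⇒a≈e e≤a e≤a* , e≤a*⇒a≈e e≤b e≤b*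
    where
    collapsed : y j * * ≈ e × y i ≈ e
    collapsed = blockRank-≺ l
      (≤-trans (x≤x** (y i)) (≤-resp a*≈ b*≈ (*-antitone b≤a)))
    e≤b* : e ≤ b *
    e≤b* = ≤-reflexive (≈-sym (≈-trans b*≈ (proj₁ collapsed)))
    e≤a* : e ≤ a *
    e≤a* = ≤-resp (proj₂ collapsed) (≈-sym a*≈) (x≤x** (y i))

  block<⇒≺ : ∀ {a b} → View a → View b → U.block (position a) ℤ.< U.block (position b) → value a ≺ value b
  block<⇒≺ (isUnit q _) (isUnit r _) p = contradiction (subst₂ ℤ._<_ q r p) (ℤ.<-irrefl refl)
  block<⇒≺ (isUnit q _) (isNeg _ r _ _) p = contradiction (subst₂ ℤ._<_ q r p) λ ()
  block<⇒≺ (isUnit _ q) (isPos _ _ r _) p = ≤e≤⇒≺ (≤-reflexive q) r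
  block<⇒≺ (isNeg i _ _ q) (isUnit _ r) p = ≤e≤⇒≺ (≤-trans q (closed-≤e i)) (≤-reflexive (≈-sym r))
  block<⇒≺ (isNeg i q _ q′) (isNeg j r r′ _) p =
    ≤-≺-≤ q′ (blockRank-≺ (ℤ.drop‿-<- (subst₂ ℤ._<_ q r p))) r′
  block<⇒≺ (isNeg i _ _ q) (isPos _ _ r _) p = ≤e≤⇒≺ (≤-trans q (closed-≤e i)) r
  block<⇒≺ (isPos _ q _ _) (isUnit r _) p = contradiction (subst₂ ℤ._<_ q r p) λ { (ℤ.+<+ ()) }
  block<⇒≺ (isPos _ q _ _) (isNeg _ r _ _) p = contradiction (subst₂ ℤ._<_ q r p) λ ()
  block<⇒≺ (isPos i q q′ q″) (isPos j r r′ r″) p =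
    positive-≺ (ℕ.s<s⁻¹ (ℤ.drop‿+<+ (subst₂ ℤ._<_ q r p))) q′ q″ r′ r″

  closed-cong : ∀ {σ τ i j} → signed σ (blockRank i) ≡ signed τ (blockRank j) → closed σ i ≈ closed τ j
  closed-cong {⊖} {⊖} {i} {j} p = *-cong (blockRank-≈ (ℤ.-[1+-injective p))
  closed-cong {⊕} {⊕} {i} {j} p = blockRank-≈ (ℤ.+[1+-injective p)

  signed≢0 : ∀ {σ k} → ¬ (signed σ k ≡ 0ℤ)
  signed≢0 {⊖} ()
  signed≢0 {⊕} ()

  depth<⇒≺ : ∀ a b → U.block (position a) ≡ U.block (position b) →
    U.depth (position b) ℕ.< U.depth (position a) → value a ≺ value b
  depth<⇒≺ unit       _          _ ()
  depth<⇒≺ (hull _ _) _          _ ()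
  depth<⇒≺ (gen i _)  unit       p _ = contradiction p signed≢0
  depth<⇒≺ (gen i q)  (hull σ j) p _ = ≺-resp ≈-refl (≈-trans (x**≈closed i) (closed-cong {s i} {σ} p)) q
  depth<⇒≺ (gen i _)  (gen j _)  _ p = depthRank-≺ (ℕ.s<s⁻¹ p)

  ≺≺⇒value≺ : ∀ a b → position a ≺≺ position b → value a ≺ value b
  ≺≺⇒value≺ a b p = [ block<⇒≺ (view a) (view b) , (λ (q , r) → depth<⇒≺ a b q r) ]′ (≺≺-inv p)

  position-≡⇒≈ : ∀ a b → position a ≡ position b → value a ≈ value b
  position-≡⇒≈ unit unit p = ≈-refl
  position-≡⇒≈ unit (hull _ _) p = contradiction (sym (cong U.block p)) signed≢0
  position-≡⇒≈ unit (gen _ _) p = contradiction (sym (cong U.block p)) signed≢0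
  position-≡⇒≈ (hull _ _) unit p = contradiction (cong U.block p) signed≢0
  position-≡⇒≈ (hull σ i) (hull τ j) p = closed-cong {σ} {τ} (cong U.block p)
  position-≡⇒≈ (hull _ _) (gen _ _) p = contradiction (cong U.depth p) λ ()
  position-≡⇒≈ (gen _ _) unit p = contradiction (cong U.depth p) λ ()
  position-≡⇒≈ (gen _ _) (hull _ _) p = contradiction (cong U.depth p) λ ()
  position-≡⇒≈ (gen i _) (gen j _) p = depthRank-≈ (ℕ.suc-injective (cong U.depth p))

  star : Label → Label
  star unit       = unit
  star (hull σ i) = hull (opposite σ) i
  star (gen i _)  = hull (opposite (s i)) i

  position-star : ∀ a → position (star a) ≡ position a ⋆
  position-star unit       = refl
  position-star (hull ⊖ i) = refl
  position-star (hull ⊕ i) = refl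
  position-star (gen i _) with s i
  ... | ⊖ = refl
  ... | ⊕ = refl

  value-star : ∀ a → value (star a) ≈ value a *
  value-star unit       = ≈-sym e*≈e
  value-star (hull ⊖ i) = ≈-sym (x***≈x* _)
  value-star (hull ⊕ i) = ≈-refl
  value-star (gen i _)  = ≈-sym (x*≈closed i)

  correspondence : Correspondence (𝐔-isChain {ℓ}) L
  correspondence = record
    { R = λ u l → Σ[ a ∈ Label ] position a ≡ u × value a ≈ l
    ; R-resp = λ { refl p (a , q , r) → a , q , ≈-trans r p }
    ; R-e = unit , refl , ≈-refl
    ; R-* = λ { (a , refl , r) → star a , trans (position-star a) (sym (*≡⋆ _)) , ≈-trans (value-star a) (*-cong r) }
    ; compare = λ { (a , refl , r) (b , refl , t) → cmp a b r t } }
    where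
    cmp : ∀ a b {l l′} → value a ≈ l → value b ≈ l′ →
      (position a 𝒰.≤ position b × l ≤ l′) ⊎ (position b 𝒰.≺ position a × l′ ≺ l)
    cmp a b r t with ≼⊎≻≻ (position a) (position b)
    ... | inj₂ p = inj₂ (≺≺⇒≺ p , ≺-resp t r (≺≺⇒value≺ b a p))
    ... | inj₁ p with ≼⊎≻≻ (position b) (position a)
    ...   | inj₁ q = inj₁ (≼⇒≤ p , ≤-resp r t (≤-reflexive (position-≡⇒≈ a b (≼-antisym p q))))
    ...   | inj₂ q = inj₁ (≼⇒≤ p , ≤-resp r t (≺⇒≤ (≺≺⇒value≺ a b q)))

  labelFor : ∀ i → x i ≈ x i * * ⊎ x i ≺ x i * * → Label
  labelFor i (inj₁ _) = hull (s i) i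
  labelFor i (inj₂ p) = gen i p

  value-labelFor : ∀ i d → value (labelFor i d) ≈ x i
  value-labelFor i (inj₁ p) = ≈-trans (≈-sym (x**≈closed i)) (≈-sym p)
  value-labelFor i (inj₂ _) = ≈-refl

  signed∈ : ∀ σ i → signed σ (blockRank i) ∈ˡ (map +_ (upTo (suc N)) ++ map -[1+_] (upTo N))
  signed∈ ⊖ i = ∈-++⁺ʳ (map +_ (upTo (suc N))) (∈-map⁺ -[1+_] (∈-upTo⁺ (blockRank<N i)))
  signed∈ ⊕ i = ∈-++⁺ˡ (∈-map⁺ +_ (∈-upTo⁺ (ℕ.s≤s (blockRank<N i))))

  position∈box : ∀ i d → position (labelFor i d) ∈ˡ box N
  position∈box i (inj₁ _) = ∈-cartesianProductWith⁺ _,_ (signed∈ (s i) i) (∈-upTo⁺ (ℕ.s≤s ℕ.z≤n))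
  position∈box i (inj₂ _) =
    ∈-cartesianProductWith⁺ _,_ (signed∈ (s i) i) (∈-upTo⁺ (ℕ.s≤s (depthRank<N i)))

  label : Fin N → Label
  label i = labelFor i (≤⇒≈⊎≺ (x≤x** (x i)))

module _ {ℓ} {𝐋 : Algebra ℓ} (L : IsChain 𝐋) where
  open Chain L

  -- The list of candidate valuations depends on `N` alone and not on the chain, which is what
  -- allows one interpolating term for all chains. Equalities pass only from `𝐔` to `𝐋`, since the
  -- representation may identify positions.
  represent : ∀ N (ρ : ℕ → Carrier) → Σ[ v ∈ (ℕ → U ℓ) ] v ∈ˡ valuations N N ×
    (∀ s t → bound s ℕ.≤ N → bound t ℕ.≤ N → eval 𝐔 v s ≡ eval 𝐔 v t → eval 𝐋 ρ s ≈ eval 𝐋 ρ t)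
  represent N ρ = v , v∈ , transfer
    where
    x = λ i → ρ (toℕ i)
    open Representation L {N} x
    open Correspondence correspondence using (R)
    found = ∈-valuations N (λ i → position (label i)) (λ i → position∈box i (≤⇒≈⊎≺ (x≤x** (x i))))
    v = proj₁ found
    v∈ = proj₁ (proj₂ found)
    v-label = proj₂ (proj₂ found)

    related : ∀ i → i ℕ.< N → R (v i) (ρ i)
    related i i<N = label j , trans (sym (v-label j)) (cong v i≡) , ≈-trans (value-labelFor j (≤⇒≈⊎≺ (x≤x** (x j)))) (≈-reflexive (cong ρ i≡))
      where
      j = fromℕ< i<N
      i≡ : toℕ j ≡ i
      i≡ = Fin.toℕ-fromℕ< i<N

    transfer : ∀ s t → bound s ℕ.≤ N → bound t ℕ.≤ N → eval 𝐔 v s ≡ eval 𝐔 v t → eval 𝐋 ρ s ≈ eval 𝐋 ρ t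
    transfer s t p q eq =
      let a , a≡ , a≈ = R-eval correspondence s λ i r → related i (ℕ.<-≤-trans r p)
          b , b≡ , b≈ = R-eval correspondence t λ i r → related i (ℕ.<-≤-trans r q)
      in ≈-trans (≈-sym a≈) (≈-trans (position-≡⇒≈ a b (trans a≡ (trans eq (sym b≡)))) b≈)

-- Quotients of the universal chain

-- The quotient of the universal chain by the filter generated by h ≤ e, realised
-- inside the universal chain: [h , h ⋆] collapses to e, and what remains of the
-- block of h moves to block 0, since its image under ⋆ has become e.
module Collapse {ℓ} (h : U ℓ) (h≼e : h ≼ 𝐞) where
  private
    module 𝒰 = Chain (𝐔-isChain {ℓ})
    z₀ = U.block h
    j₀ = U.depth h

    z₀≤0 : z₀ ℤ.≤ 0ℤ
    z₀≤0 = ≼⇒block≤ h≼e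

    ≼⋆⋆ : ∀ {x : U ℓ} → x ≼ (x ⋆) ⋆
    ≼⋆⋆ = ⋆-galois (≼-reflexive refl)

    ⋆-antitone : ∀ {x y : U ℓ} → x ≼ y → (y ⋆) ≼ (x ⋆)
    ⋆-antitone p = ⋆-galois (≼-trans p ≼⋆⋆)

    e≼h⋆ : 𝐞 ≼ h ⋆
    e≼h⋆ = ⋆-antitone h≼e

    -- The graph of the quotient map. In `tail` the depth can be kept: it exceeds `j₀`, so it is
    -- positive and the image stays strictly below `e`.
    data Collapses : U ℓ → U ℓ → Set ℓ where
      mid  : ∀ {x} → h ≼ x → x ≼ h ⋆ → Collapses x 𝐞
      high : ∀ {x} → h ⋆ ≺≺ x → Collapses x x
      low  : ∀ {x} → U.block x ℤ.< z₀ → Collapses x x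
      tail : ∀ {d} → j₀ ℕ.< d → Collapses (z₀ , d) (0ℤ , d)

    low≺≺ : ∀ {x} → U.block x ℤ.< z₀ → x ≺≺ h
    low≺≺ p = block< p

    tail≺≺ : ∀ {d} → j₀ ℕ.< d → (z₀ , d) ≺≺ h
    tail≺≺ p = depth< p

    collapses : ∀ x → Σ[ u ∈ U ℓ ] Collapses x u
    collapses x with ≼⊎≻≻ h x
    collapses x | inj₁ p with ≼⊎≻≻ x (h ⋆)
    ... | inj₁ q = 𝐞 , mid p q
    ... | inj₂ q = x , high q
    collapses x | inj₂ (block< p) = x , low p
    collapses x | inj₂ (depth< p) = _ , tail p

    collapses-⋆ : ∀ {x u} → Collapses x u → Collapses (x ⋆) (u ⋆)
    collapses-⋆ (mid p q) = mid (⋆-galois q) (⋆-antitone p)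
    collapses-⋆ (high (block< p)) = low (subst (_ ℤ.<_) (ℤ.neg-involutive z₀) (ℤ.neg-mono-< p))
    collapses-⋆ (low p) = high (block< (ℤ.neg-mono-< p))
    collapses-⋆ (tail p) = mid (≼-trans h≼e e≼h⋆) (≼-reflexive refl)

    low≼e : ∀ {x : U ℓ} → U.block x ℤ.< z₀ → x ≼ 𝐞
    low≼e p = block< (ℤ.<-≤-trans p z₀≤0)

    collapses-≺ : ∀ {x u y w} → Collapses x u → Collapses y w → x ≺≺ y → u 𝒰.≺ w
    collapses-≺ (mid _ _) (mid _ _) r = λ _ → refl , refl
    collapses-≺ (mid _ _) (high p)  r = 𝒰.≤e≤⇒≺ 𝒰.≤-refl (≼⇒≤ (≼-trans e≼h⋆ (≺≺⇒≼ p)))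
    collapses-≺ (mid p _) (low q)   r = contradiction (≼-trans p (≺≺⇒≼ r)) (≺≺⇒⋡ (low≺≺ q))
    collapses-≺ (mid p _) (tail q)  r = contradiction (≼-trans p (≺≺⇒≼ r)) (≺≺⇒⋡ (tail≺≺ q))
    collapses-≺ (high p)  (mid _ q) r = contradiction (≼-trans (≺≺⇒≼ r) q) (≺≺⇒⋡ p)
    collapses-≺ (high _)  (high _)  r = ≺≺⇒≺ r
    collapses-≺ (high p)  (low q)   r =
      contradiction (≼-trans h≼e (≼-trans e≼h⋆ (≼-trans (≺≺⇒≼ p) (≺≺⇒≼ r)))) (≺≺⇒⋡ (low≺≺ q))
    collapses-≺ (high p)  (tail q)  r =
      contradiction (≼-trans h≼e (≼-trans e≼h⋆ (≼-trans (≺≺⇒≼ p) (≺≺⇒≼ r)))) (≺≺⇒⋡ (tail≺≺ q))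
    collapses-≺ (low p)   (mid _ _) r = 𝒰.≤e≤⇒≺ (≼⇒≤ (low≼e p)) 𝒰.≤-refl
    collapses-≺ (low p)   (high q)  r = 𝒰.≤e≤⇒≺ (≼⇒≤ (low≼e p)) (≼⇒≤ (≼-trans e≼h⋆ (≺≺⇒≼ q)))
    collapses-≺ (low _)   (low _)   r = ≺≺⇒≺ r
    collapses-≺ (low p)   (tail _)  r = ≺≺⇒≺ (block< (ℤ.<-≤-trans p z₀≤0))
    collapses-≺ (tail _)  (mid _ _) r = 𝒰.≤e≤⇒≺ (≼⇒≤ (≼⋆ ℤ.≤-refl)) 𝒰.≤-refl
    collapses-≺ (tail _)  (high q)  r = 𝒰.≤e≤⇒≺ (≼⇒≤ (≼⋆ ℤ.≤-refl)) (≼⇒≤ (≼-trans e≼h⋆ (≺≺⇒≼ q)))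
    collapses-≺ (tail _)  (low q)   r = contradiction (≼⇒block≤ (≺≺⇒≼ r)) (ℤ.<⇒≱ q)
    collapses-≺ (tail _)  (tail _)  (block< r) = contradiction r (ℤ.<-irrefl refl)
    collapses-≺ (tail _)  (tail _)  (depth< r) = ≺≺⇒≺ (depth< r)

    collapses-unique : ∀ {x u w} → Collapses x u → Collapses x w → u ≡ w
    collapses-unique (mid _ _) (mid _ _) = refl
    collapses-unique (mid _ p) (high q)  = contradiction p (≺≺⇒⋡ q)
    collapses-unique (mid p _) (low q)   = contradiction p (≺≺⇒⋡ (low≺≺ q))
    collapses-unique (mid p _) (tail q)  = contradiction p (≺≺⇒⋡ (tail≺≺ q))
    collapses-unique (high p)  (mid _ q) = contradiction q (≺≺⇒⋡ p)
    collapses-unique (high _)  (high _)  = refl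
    collapses-unique (high _)  (low _)   = refl
    collapses-unique (high p)  (tail q)  =
      contradiction (≼-trans h≼e (≼-trans e≼h⋆ (≺≺⇒≼ p))) (≺≺⇒⋡ (tail≺≺ q))
    collapses-unique (low p)   (mid q _) = contradiction q (≺≺⇒⋡ (low≺≺ p))
    collapses-unique (low _)   (high _)  = refl
    collapses-unique (low _)   (low _)   = refl
    collapses-unique (low p)   (tail _)  = contradiction p (ℤ.<-irrefl refl)
    collapses-unique (tail p)  (mid q _) = contradiction q (≺≺⇒⋡ (tail≺≺ p))
    collapses-unique (tail p)  (high q)  =
      contradiction (≼-trans h≼e (≼-trans e≼h⋆ (≺≺⇒≼ q))) (≺≺⇒⋡ (tail≺≺ p))
    collapses-unique (tail _)  (low p)   = contradiction p (ℤ.<-irrefl refl)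
    collapses-unique (tail _)  (tail _)  = refl

    e≼⇒h≼′ : ∀ {x u} → Collapses x u → 𝐞 ≼ u → h ≼ x
    e≼⇒h≼′ (mid p _) _ = p
    e≼⇒h≼′ (high p)  _ = ≼-trans h≼e (≼-trans e≼h⋆ (≺≺⇒≼ p))
    e≼⇒h≼′ (low p)   q = contradiction (≼⇒block≤ q) (ℤ.<⇒≱ (ℤ.<-≤-trans p z₀≤0))
    e≼⇒h≼′ (tail p)  (block< q) = contradiction q (ℤ.<-irrefl refl)
    e≼⇒h≼′ (tail ()) (depth≤ ℕ.z≤n)

  abstract
    π : U ℓ → U ℓ
    π x = proj₁ (collapses x)

    private
      π-collapses : ∀ x → Collapses x (π x)
      π-collapses x = proj₂ (collapses x)

    π-nearEmbedding : NearEmbedding π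
    π-nearEmbedding = record
      { φ-e = collapses-unique (π-collapses 𝐞) (mid h≼e e≼h⋆)
      ; φ-⋆ = λ x → collapses-unique (π-collapses (x ⋆)) (collapses-⋆ (π-collapses x))
      ; φ-≺ = collapses-≺ (π-collapses _) (π-collapses _) }

    π≡e : ∀ {x} → h ≼ x → x ≼ h ⋆ → π x ≡ 𝐞
    π≡e p q = collapses-unique (π-collapses _) (mid p q)

    e≼π⇒h≼ : ∀ x → 𝐞 ≼ π x → h ≼ x
    e≼π⇒h≼ x = e≼⇒h≼′ (π-collapses x)

  open NearEmbedding π-nearEmbedding public
    renaming (φ-e to π-e; φ-⋆ to π-⋆; φ-≺ to π-≺; φ-mono to π-mono; eval-φ to eval-π) using ()

  π-h : π h ≡ 𝐞
  π-h = π≡e (≼-reflexive refl) (≼-trans h≼e e≼h⋆)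

  π≡e⁻ : ∀ {x} → π x ≡ 𝐞 → h ≼ x × x ≼ h ⋆
  π≡e⁻ {x} p = e≼π⇒h≼ x (≼-reflexive (sym p))
             , ⋆-galois (e≼π⇒h≼ (x ⋆) (≼-reflexive (sym (trans (π-⋆ x) (cong _⋆ p)))))

  absorbs-h : ∀ {x} → π x ≡ 𝐞 → x 𝒰.· h ≡ h
  absorbs-h p = let h≼x , x≼h⋆ = π≡e⁻ p in
    trans (𝒰.≤*⇒·≈∧ (subst (_ 𝒰.≤_) (sym (*≡⋆ h)) (≼⇒≤ x≼h⋆))) (𝒰.y≤x⇒x∧y≈y (≼⇒≤ h≼x))

  -- Distinct elements with the same image both lie in the collapsed interval, where multiplication
  -- by `h` gives `h`. This converts an equality in the quotient into an equation of terms.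
  π-kernel : ∀ {x y} → π x ≡ π y → x 𝒰.· h ≡ y 𝒰.· h
  π-kernel {x} {y} p with ≼⊎≻≻ x y | ≼⊎≻≻ y x
  ... | inj₁ q | inj₁ r = cong (𝒰._· h) (≼-antisym q r)
  ... | inj₂ q | _ = let πy≡e , πx≡e = π-≺ q (𝒰.≤-reflexive p) in trans (absorbs-h πx≡e) (sym (absorbs-h πy≡e))
  ... | _ | inj₂ q = let πx≡e , πy≡e = π-≺ q (𝒰.≤-reflexive (sym p)) in trans (absorbs-h πx≡e) (sym (absorbs-h πy≡e))

-- Amalgamation inside the universal chain

module _ {P : Pred ℕ 0ℓ} (P? : Decidable P) (b : ℕ → ℕ) where

  supremum : ℕ → ℕ
  supremum zero = 0
  supremum (suc m) with P? m
  ... | yes _ = b m ℕ.⊔ supremum m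
  ... | no  _ = supremum m

  ≤supremum : ∀ {m k} → k ℕ.< m → P k → b k ℕ.≤ supremum m
  ≤supremum {suc m} {k} (ℕ.s≤s k≤m) Pk with P? m | ℕ.m≤n⇒m<n∨m≡n k≤m
  ... | yes _ | inj₁ k<m  = ℕ.≤-trans (≤supremum k<m Pk) (ℕ.m≤n⊔m (b m) _)
  ... | yes _ | inj₂ refl = ℕ.m≤m⊔n (b m) _
  ... | no _  | inj₁ k<m  = ≤supremum k<m Pk
  ... | no ¬P | inj₂ refl = contradiction Pk ¬P

  supremum≤ : ∀ {c} m → (∀ k → k ℕ.< m → P k → b k ℕ.≤ c) → supremum m ℕ.≤ c
  supremum≤ zero p = ℕ.z≤n
  supremum≤ (suc m) p with P? m
  ... | yes Pm = ℕ.⊔-lub (p m ℕ.≤-refl Pm) (supremum≤ m λ k k<m → p k (ℕ.m<n⇒m<1+n k<m))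
  ... | no _   = supremum≤ m λ k k<m → p k (ℕ.m<n⇒m<1+n k<m)

StrictlyIncreasing : (ℕ → ℕ) → Set
StrictlyIncreasing f = ∀ {x y} → x ℕ.< y → f x ℕ.< f y

-- Amalgamating two chains along a_k ↔ b_k: stretching one side by b and the other
-- by a sends both a_k and b_k to a_k + b_k.
module Stretch {C : Pred ℕ 0ℓ} (C? : Decidable C) (a b : ℕ → ℕ) (m : ℕ) where
  private
    below? : ∀ x → Decidable (λ k → C k × a k ℕ.≤ x)
    below? x k = C? k ×-dec (a k ℕ.≤? x)

  stretch : ℕ → ℕ
  stretch x = x ℕ.+ supremum (below? x) b m

  -- A larger argument admits more indices, so the added supremum is weakly increasing while `x`
  -- itself increases strictly.
  stretch-< : StrictlyIncreasing stretch
  stretch-< {x} {y} x<y = ℕ.+-mono-<-≤ x<y (supremum≤ (below? x) b m λ k k<m (Ck , a≤x) →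
    ≤supremum (below? y) b k<m (Ck , ℕ.≤-trans a≤x (ℕ.<⇒≤ x<y)))

  stretch-0 : (∀ k → k ℕ.< m → C k → a k ℕ.≤ 0 → b k ℕ.≤ 0) → stretch 0 ≡ 0
  stretch-0 p = ℕ.n≤0⇒n≡0 (supremum≤ (below? 0) b m λ k k<m (Ck , a≤0) → p k k<m Ck a≤0)

  stretch-at : ∀ {k} → k ℕ.< m → C k → (∀ l → l ℕ.< m → C l → a l ℕ.≤ a k → b l ℕ.≤ b k) →
    stretch (a k) ≡ a k ℕ.+ b k
  stretch-at {k} k<m Ck p = cong (a k ℕ.+_) (ℕ.≤-antisym
    (supremum≤ (below? (a k)) b m λ l l<m (Cl , q) → p l l<m Cl q)
    (≤supremum (below? (a k)) b k<m (Ck , ℕ.≤-refl)))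

odd : (ℕ → ℕ) → ℤ → ℤ
odd f (+ n)    = + f n
odd f -[1+ n ] = - (+ f (suc n))

module _ {f : ℕ → ℕ} (f-< : StrictlyIncreasing f) (f-0 : f 0 ≡ 0) where

  odd-< : ∀ {z w} → z ℤ.< w → odd f z ℤ.< odd f w
  odd-< (ℤ.-<- p) = ℤ.neg-mono-< (ℤ.+<+ (f-< (ℕ.s≤s p)))
  odd-< { -[1+ m ]} {+ n} ℤ.-<+ = ℤ.<-≤-trans (ℤ.neg-mono-< (ℤ.+<+ (ℕ.≤-<-trans ℕ.z≤n (f-< (ℕ.s≤s ℕ.z≤n)))))
                                    (ℤ.+≤+ ℕ.z≤n)
  odd-< (ℤ.+<+ p) = ℤ.+<+ (f-< p)

  odd-neg : ∀ z → odd f (- z) ≡ - odd f z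
  odd-neg (+ zero)  = trans (cong +_ f-0) (cong (λ n → - (+ n)) (sym f-0))
  odd-neg +[1+ n ]  = refl
  odd-neg -[1+ n ]  = sym (ℤ.neg-involutive _)

module _ {ℓ : Level} where
  private module 𝒰 = Chain (𝐔-isChain {ℓ})

  module Embed {f : ℕ → ℕ} (f-< : StrictlyIncreasing f) (f-0 : f 0 ≡ 0)
    {g : ℤ → ℕ → ℕ} (g-< : ∀ z → StrictlyIncreasing (g z)) (g-0 : ∀ z → g z 0 ≡ 0) where

    embed : U ℓ → U ℓ
    embed (z , j) = odd f z , g z j

    embed-≺≺ : ∀ {x y} → x ≺≺ y → embed x ≺≺ embed y
    embed-≺≺ (block< p) = block< (odd-< f-< f-0 p)
    embed-≺≺ {z , _} (depth< p) = depth< (g-< z p)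

    embed-nearEmbedding : NearEmbedding embed
    embed-nearEmbedding = record
      { φ-e = cong₂ _,_ (cong +_ f-0) (g-0 0ℤ)
      ; φ-⋆ = λ { (z , _) → cong₂ _,_ (odd-neg f-< f-0 z) (g-0 (- z)) }
      ; φ-≺ = λ p → ≺≺⇒≺ (embed-≺≺ p) }

    embed-injective : ∀ {x y} → embed x ≡ embed y → x ≡ y
    embed-injective {x} {y} p with ≼⊎≻≻ x y | ≼⊎≻≻ y x
    ... | inj₁ q | inj₁ r = ≼-antisym q r
    ... | inj₂ q | _ = contradiction (≼-reflexive p) (≺≺⇒⋡ (embed-≺≺ q))
    ... | _ | inj₂ q = contradiction (≼-reflexive (sym p)) (≺≺⇒⋡ (embed-≺≺ q))

  ∘-nearEmbedding : ∀ {φ ψ : U ℓ → U ℓ} → NearEmbedding φ → NearEmbedding ψ → NearEmbedding (λ x → φ (ψ x))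
  ∘-nearEmbedding {φ} {ψ} F G = record
    { φ-e = trans (cong φ G.φ-e) F.φ-e
    ; φ-⋆ = λ x → trans (cong φ (G.φ-⋆ x)) (F.φ-⋆ (ψ x))
    ; φ-≺ = λ p → composite (G.φ-≺ p) }
    where
    module F = NearEmbedding F
    module G = NearEmbedding G
    composite : ∀ {x y} → x 𝒰.≺ y → φ x 𝒰.≺ φ y
    composite {x} {y} p with ≼⊎≻≻ y x
    ... | inj₂ q = F.φ-≺ q
    ... | inj₁ q = let x≡e , y≡e = p (≼⇒≤ q) in λ _ → trans (cong φ x≡e) F.φ-e , trans (cong φ y≡e) F.φ-e

  eval-* : ∀ (v : ℕ → U ℓ) t → eval 𝐔 v (t *ᵗ) ≡ eval 𝐔 v t ⋆
  eval-* v t = *≡⋆ (eval 𝐔 v t)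

  eval-var** : ∀ (v : ℕ → U ℓ) k → eval 𝐔 v (var k *ᵗ *ᵗ) ≡ (U.block (v k) , 0)
  eval-var** v k = trans (eval-* v (var k *ᵗ)) (trans (cong _⋆ (eval-* v (var k)))
    (cong (_, 0) (ℤ.neg-involutive (U.block (v k)))))

  LabelOrder : ℕ → (p q : ℕ → U ℓ) → Set
  LabelOrder m p q = ∀ {a b} → a ∈ˡ labels m → b ∈ˡ labels m →
    eval 𝐔 p a ≼ eval 𝐔 p b → eval 𝐔 q a ≼ eval 𝐔 q b

∣∣≤⇒≤ : ∀ {x n} → ∣ x ∣ ℕ.≤ n → x ℤ.≤ + n × (- x) ℤ.≤ + n
∣∣≤⇒≤ {+ _} p      = ℤ.+≤+ p , ℤ.≤-trans ℤ.neg-≤-pos (ℤ.+≤+ p)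
∣∣≤⇒≤ { -[1+ _ ]} p = ℤ.-≤+ , ℤ.+≤+ p

≤⇒∣∣≤ : ∀ {x y} → x ℤ.≤ y → (- x) ℤ.≤ y → ∣ x ∣ ℕ.≤ ∣ y ∣
≤⇒∣∣≤ {+ _}       (ℤ.+≤+ p) _ = p
≤⇒∣∣≤ { -[1+ _ ]} _ (ℤ.+≤+ p) = p

-- The map for one side, sending `p k` to the coordinatewise sum of `p k` and `q k`. This target is
-- symmetric, so exchanging `p` and `q` gives a matching map for the other side.
module HalfAmalgam {ℓ} (m : ℕ) (p q : ℕ → U ℓ) (order : LabelOrder m p q) where
  z y : ℕ → ℤ
  z k = U.block (p k)
  y k = U.block (q k)
  j i : ℕ → ℕ
  j k = U.depth (p k)
  i k = U.depth (q k)

  module _ {k} (k<m : k ℕ.< m) where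
    var∈  = proj₁ (var∈labels k<m)
    var*∈ = proj₁ (proj₂ (var∈labels k<m))
    var**∈ = proj₂ (proj₂ (var∈labels k<m))

  transfer : ∀ {a b A B A′ B′} → a ∈ˡ labels m → b ∈ˡ labels m →
    eval 𝐔 p a ≡ A → eval 𝐔 p b ≡ B → eval 𝐔 q a ≡ A′ → eval 𝐔 q b ≡ B′ → A ≼ B → A′ ≼ B′
  transfer a∈ b∈ refl refl refl refl = order a∈ b∈

  block-≤ : ∀ {k l} → k ℕ.< m → l ℕ.< m → z k ℤ.≤ z l → y k ℤ.≤ y l
  block-≤ {k} {l} k<m l<m r = ≼⇒block≤ (transfer (var**∈ k<m) (var**∈ l<m)
    (eval-var** p k) (eval-var** p l) (eval-var** q k) (eval-var** q l) (≼⋆ r))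

  block-≤- : ∀ {k l} → k ℕ.< m → l ℕ.< m → z k ℤ.≤ - z l → y k ℤ.≤ - y l
  block-≤- {k} {l} k<m l<m r = ≼⇒block≤ (transfer (var**∈ k<m) (var*∈ l<m)
    (eval-var** p k) (eval-* p (var l)) (eval-var** q k) (eval-* q (var l)) (≼⋆ r))

  block--≤ : ∀ {k l} → k ℕ.< m → l ℕ.< m → - z k ℤ.≤ z l → - y k ℤ.≤ y l
  block--≤ {k} {l} k<m l<m r = ≼⇒block≤ (transfer (var*∈ k<m) (var**∈ l<m)
    (eval-* p (var k)) (eval-var** p l) (eval-* q (var k)) (eval-var** q l) (≼⋆ r))

  block≤0 : ∀ {k} → k ℕ.< m → z k ℤ.≤ 0ℤ → y k ℤ.≤ 0ℤ
  block≤0 {k} k<m r = ≼⇒block≤ (transfer (var**∈ k<m) (e∈labels m)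
    (eval-var** p k) refl (eval-var** q k) refl (≼⋆ r))

  block≥0 : ∀ {k} → k ℕ.< m → 0ℤ ℤ.≤ z k → 0ℤ ℤ.≤ y k
  block≥0 {k} k<m r = ≼⇒block≤ (transfer (e∈labels m) (var**∈ k<m)
    refl (eval-var** p k) refl (eval-var** q k) (≼⋆ r))

  -- A comparison of absolute values is a pair of comparisons between tops of blocks, which are the
  -- values of `var k *ᵗ` and `var k *ᵗ *ᵗ`; the sign of `z l` selects the pair.
  abs-≤ : ∀ {k l} → k ℕ.< m → l ℕ.< m → ∣ z k ∣ ℕ.≤ ∣ z l ∣ → ∣ y k ∣ ℕ.≤ ∣ y l ∣
  abs-≤ {k} {l} k<m l<m r with ℤ.≤-total 0ℤ (z l)
  ... | inj₁ s = let u , v = ∣∣≤⇒≤ r; ∣z∣≡z = ℤ.0≤i⇒+∣i∣≡i s in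
        ≤⇒∣∣≤ (block-≤ k<m l<m (subst (z k ℤ.≤_) ∣z∣≡z u)) (block--≤ k<m l<m (subst (- z k ℤ.≤_) ∣z∣≡z v))
  ... | inj₂ s = let u , v = ∣∣≤⇒≤ {z k} r
                     ∣z∣≡-z = trans (cong +_ (sym (ℤ.∣-i∣≡∣i∣ (z l)))) (ℤ.0≤i⇒+∣i∣≡i (ℤ.neg-mono-≤ s))
        in subst (∣ y k ∣ ℕ.≤_) (ℤ.∣-i∣≡∣i∣ (y l))
          (≤⇒∣∣≤ (block-≤- k<m l<m (subst (z k ℤ.≤_) ∣z∣≡-z u))
                 (ℤ.neg-mono-≤ (block-≤ l<m k<m (ℤ.neg-cancel-≤ (subst (- z k ℤ.≤_) ∣z∣≡-z v)))))

  abs-0 : ∀ {k} → k ℕ.< m → ∣ z k ∣ ℕ.≤ 0 → ∣ y k ∣ ℕ.≤ 0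
  abs-0 {k} k<m r = let u , v = ∣∣≤⇒≤ {z k} r in
    ≤⇒∣∣≤ {y k} (block≤0 k<m u) (ℤ.neg-mono-≤ (block≥0 k<m (ℤ.neg-cancel-≤ v)))

  block-≡ : ∀ {k l} → k ℕ.< m → l ℕ.< m → z k ≡ z l → y k ≡ y l
  block-≡ k<m l<m r = ℤ.≤-antisym (block-≤ k<m l<m (ℤ.≤-reflexive r)) (block-≤ l<m k<m (ℤ.≤-reflexive (sym r)))

  depth-inv : ∀ {x w : U ℓ} → U.block x ≡ U.block w → x ≼ w → U.depth w ℕ.≤ U.depth x
  depth-inv r (block< s) = contradiction s (ℤ.<-irrefl r)
  depth-inv r (depth≤ s) = s

  depth-≼ : ∀ {x w : U ℓ} → U.block x ≡ U.block w → U.depth w ℕ.≤ U.depth x → x ≼ w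
  depth-≼ refl r = depth≤ r

  depth-≤ : ∀ {k l} → k ℕ.< m → l ℕ.< m → z k ≡ z l → j k ℕ.≤ j l → i k ℕ.≤ i l
  depth-≤ k<m l<m r s = depth-inv (block-≡ l<m k<m (sym r)) (order (var∈ l<m) (var∈ k<m) (depth-≼ (sym r) s))

  -- Having depth 0 is visible in the order of the labels: it means that the closure of the element
  -- lies below the element.
  depth-0 : ∀ {k} → k ℕ.< m → j k ℕ.≤ 0 → i k ℕ.≤ 0
  depth-0 {k} k<m r = depth-inv refl (transfer (var**∈ k<m) (var∈ k<m)
    (eval-var** p k) refl (eval-var** q k) refl (depth-≼ {z k , 0} {p k} refl r))

  private
    always : Decidable {A = ℕ} (λ _ → ⊤)
    always _ = yes tt

    inBlock : ∀ w → Decidable (λ k → z k ≡ w)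
    inBlock w k = z k ℤ.≟ w

    module F = Stretch always (λ k → ∣ z k ∣) (λ k → ∣ y k ∣) m
    module G w = Stretch (inBlock w) j i m

    F-0 : F.stretch 0 ≡ 0
    F-0 = F.stretch-0 λ k k<m _ → abs-0 k<m

    G-0 : ∀ w → G.stretch w 0 ≡ 0
    G-0 w = G.stretch-0 w λ k k<m _ → depth-0 k<m

    module E = Embed {ℓ} F.stretch-< F-0 {G.stretch} G.stretch-< G-0

  -- The blocks `z k` and `y k` never have opposite signs, so their absolute values add up to that
  -- of their sum.
  odd-at : ∀ {k} → k ℕ.< m → odd F.stretch (z k) ≡ z k ℤ.+ y k
  odd-at {k} k<m = go (z k) (y k) (F.stretch-at k<m tt λ l l<m _ → abs-≤ l<m k<m) (block≤0 k<m) (block≥0 k<m)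
    where
    go : ∀ a b → F.stretch ∣ a ∣ ≡ ∣ a ∣ ℕ.+ ∣ b ∣ → (a ℤ.≤ 0ℤ → b ℤ.≤ 0ℤ) → (0ℤ ℤ.≤ a → 0ℤ ℤ.≤ b) →
      odd F.stretch a ≡ a ℤ.+ b
    go (+ a)    (+ b)    r _ _ = cong +_ r
    go -[1+ a ] -[1+ b ] r _ _ = cong (λ n → - (+ n)) (trans r (cong suc (ℕ.+-suc a b)))
    go (+ a)    -[1+ b ] _ _ s = contradiction (s (ℤ.+≤+ ℕ.z≤n)) λ ()
    go -[1+ a ] (+ b)    r s _ with s ℤ.-≤+
    ... | ℤ.+≤+ ℕ.z≤n = cong (λ n → - (+ n)) (trans r (ℕ.+-identityʳ (suc a)))

  abstract
    embed : U ℓ → U ℓ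
    embed = E.embed

    embed-nearEmbedding : NearEmbedding embed
    embed-nearEmbedding = E.embed-nearEmbedding

    embed-injective : ∀ {x y} → embed x ≡ embed y → x ≡ y
    embed-injective = E.embed-injective

    embed-at : ∀ {k} → k ℕ.< m → embed (p k) ≡ (z k ℤ.+ y k , j k ℕ.+ i k)
    embed-at {k} k<m = cong₂ _,_ (odd-at k<m)
      (G.stretch-at (z k) k<m refl λ l l<m r → depth-≤ l<m k<m r)

-- Injectivity is asked of `φ`, along which a derived equality is pulled back; `ψ` is allowed to
-- contain a quotient.
record Amalgam {ℓ} (m : ℕ) (p q : ℕ → U ℓ) : Set ℓ where
  field
    φ ψ            : U ℓ → U ℓ
    φ-near         : NearEmbedding φ
    ψ-near         : NearEmbedding ψ
    φ-injective    : ∀ {x y} → φ x ≡ φ y → x ≡ y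
    agree          : ∀ {k} → k ℕ.< m → φ (p k) ≡ ψ (q k)

module _ {ℓ} (m : ℕ) (q p : ℕ → U ℓ) (spec : Specialises m q p) where
  open Specialises spec
  private
    module 𝒰 = Chain (𝐔-isChain {ℓ})
    open Extrema (≼-totalOrder {ℓ}) using (argmin; argmin-all; f[argmin]≤f[xs])

    -- These labels show which filter separates `q` from `p`: they lie below `e` under `q` and
    -- become `e` under `p`. The least of their values under `q` generates it.
    Kernel : Term → Set ℓ
    Kernel c = eval 𝐔 p c ≡ 𝐞 × eval 𝐔 q c ≼ 𝐞

    kernel? : Decidable Kernel
    kernel? c = (eval 𝐔 p c ≟ᵁ 𝐞) ×-dec (eval 𝐔 q c ≼? 𝐞)

    abstract
      minimum : Σ[ c ∈ Term ] c ∈ˡ labels m × Kernel c ×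
        (∀ {a} → a ∈ˡ labels m → Kernel a → eval 𝐔 q c ≼ eval 𝐔 q a)
      minimum =
        let candidates = filter kernel? (labels m)
            c∈ , k = argmin-all (eval 𝐔 q) {P = λ c → c ∈ˡ labels m × Kernel c}
              (e∈labels m , refl , ≼-reflexive refl) (All.tabulate (∈-filter⁻ kernel?))
        in argmin (eval 𝐔 q) eᵗ candidates , c∈ , k
         , λ a∈ k → All.lookup (f[argmin]≤f[xs] eᵗ candidates) (∈-filter⁺ kernel? a∈ k)

    c = proj₁ minimum
    c∈ = proj₁ (proj₂ minimum)
    pc≡e = proj₁ (proj₁ (proj₂ (proj₂ minimum)))
    h≼e = proj₂ (proj₁ (proj₂ (proj₂ minimum)))
    h = eval 𝐔 q c

    h-least : ∀ {a} → a ∈ˡ labels m → Kernel a → h ≼ eval 𝐔 q a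
    h-least = proj₂ (proj₂ (proj₂ minimum))

    open Collapse h h≼e

    e≼h⋆ : 𝐞 ≼ h ⋆
    e≼h⋆ = ⋆-galois h≼e

    ⋆-label : ∀ {a} → a ∈ˡ labels m → Σ[ b ∈ Term ] b ∈ˡ labels m × (∀ (v : ℕ → U ℓ) → eval 𝐔 v b ≡ eval 𝐔 v a ⋆)
    ⋆-label a∈ = let b , b∈ , r = *∈labels m a∈ in b , b∈ , λ v → trans (r v) (*≡⋆ _)

    kernel⇒π : ∀ {a} → a ∈ˡ labels m → eval 𝐔 p a ≡ 𝐞 → π (eval 𝐔 q a) ≡ 𝐞
    kernel⇒π {a} a∈ r = [ below , above ]′ (≼-total (eval 𝐔 q a) 𝐞)
      where
      below : eval 𝐔 q a ≼ 𝐞 → π (eval 𝐔 q a) ≡ 𝐞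
      below s = π≡e (h-least a∈ (r , s)) (≼-trans s e≼h⋆)
      above : 𝐞 ≼ eval 𝐔 q a → π (eval 𝐔 q a) ≡ 𝐞
      -- `Kernel` only sees elements below `e`, so a label above `e` is treated through the label of
      -- its image under `⋆`.
      above s = let b , b∈ , b≡ = ⋆-label a∈ in
        π≡e (≼-trans h≼e s)
            (⋆-galois (subst (h ≼_) (b≡ q) (h-least b∈ (trans (b≡ p) (cong _⋆ r)
              , subst (_≼ 𝐞) (sym (b≡ q)) (⋆-galois (≼-trans s (⋆-galois (≼-reflexive refl))))))))

    π⇒kernel : ∀ {a} → a ∈ˡ labels m → π (eval 𝐔 q a) ≡ 𝐞 → eval 𝐔 p a ≡ 𝐞
    π⇒kernel {a} a∈ r =
      let h≼ , ≼h⋆ = π≡e⁻ r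
          b , b∈ , b≡ = ⋆-label c∈
      in ≼-antisym
        (subst (eval 𝐔 p a ≼_) (trans (b≡ p) (cong _⋆ pc≡e)) (≼-specialise a∈ b∈ (subst (eval 𝐔 q a ≼_) (sym (b≡ q)) ≼h⋆)))
        (subst (_≼ eval 𝐔 p a) pc≡e (≼-specialise c∈ a∈ h≼))

    q′ : ℕ → U ℓ
    q′ k = π (q k)

    -- If `q` orders two labels strictly the other way, `≺-specialise` makes both of them `e` under
    -- `p`, so the quotient identifies them too. With `q′⇒p`, the labels are ordered alike under `p`
    -- and `q′`.
    p⇒q′ : LabelOrder m p q′
    p⇒q′ {a} {b} a∈ b∈ r = subst₂ _≼_ (eval-π q a) (eval-π q b) (go (≼⊎≻≻ (eval 𝐔 q a) (eval 𝐔 q b)))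
      where
      go : eval 𝐔 q a ≼ eval 𝐔 q b ⊎ eval 𝐔 q b ≺≺ eval 𝐔 q a → π (eval 𝐔 q a) ≼ π (eval 𝐔 q b)
      go (inj₁ s) = π-mono s
      go (inj₂ s) = let pb≡e , pa≡e = ≺-specialise b∈ a∈ s (≼⇒≤ r) in
        ≼-reflexive (trans (kernel⇒π a∈ pa≡e) (sym (kernel⇒π b∈ pb≡e)))

    q′⇒p : LabelOrder m q′ p
    q′⇒p {a} {b} a∈ b∈ r = [ ≼-specialise a∈ b∈ , collapsed ]′ (≼⊎≻≻ (eval 𝐔 q a) (eval 𝐔 q b))
      where
      collapsed : eval 𝐔 q b ≺≺ eval 𝐔 q a → eval 𝐔 p a ≼ eval 𝐔 p b
      collapsed s =
        let πb≡e , πa≡e = π-≺ s (≼⇒≤ (subst₂ _≼_ (sym (eval-π q a)) (sym (eval-π q b)) r)) in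
        ≼-reflexive (trans (π⇒kernel a∈ πa≡e) (sym (π⇒kernel b∈ πb≡e)))

    module P = HalfAmalgam m p q′ p⇒q′
    module Q = HalfAmalgam m q′ p q′⇒p

  amalgam : Amalgam m p q
  amalgam = record
    { φ = P.embed ; ψ = λ x → Q.embed (π x)
    ; φ-near = P.embed-nearEmbedding
    ; ψ-near = ∘-nearEmbedding Q.embed-nearEmbedding π-nearEmbedding
    ; φ-injective = P.embed-injective
    ; agree = λ {k} k<m → trans (P.embed-at k<m)
        (trans (cong₂ _,_ (ℤ.+-comm (P.z k) (P.y k)) (ℕ.+-comm (P.j k) (P.i k))) (sym (Q.embed-at k<m))) }

-- Interpolation

SCIRL : ∀ {ℓ} → Pred (Algebra ℓ) _
SCIRL = SemilinearCommutativeIdempotentResiduatedLattice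

module _ {ℓ} (𝐁 : Algebra ℓ) (𝐁∈ : 𝐁 ∈ SCIRL) where

  -- The generated variety lies in the variety axiomatised by this single identity.
  chains⊨⇒⊨ : ∀ {s t} → (∀ {𝐋 : Algebra ℓ} → IsChain 𝐋 → 𝐋 ⊨ (s , t)) → 𝐁 ⊨ (s , t)
  chains⊨⇒⊨ {s} {t} p = 𝐁∈ (_≡ (s , t)) (λ { L refl → p L }) refl

  𝐔⊨⇒⊨ : ∀ {s t} → 𝐔 {ℓ} ⊨ (s , t) → 𝐁 ⊨ (s , t)
  𝐔⊨⇒⊨ {s} {t} p = chains⊨⇒⊨ {s} {t} λ L ρ →
    let v , _ , transfer = represent L (bound s ℕ.⊔ bound t) ρ
    in transfer s t (ℕ.m≤m⊔n (bound s) (bound t)) (ℕ.m≤n⊔m (bound s) (bound t)) (p v)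

  open Algebra 𝐁

  ·-identityʳ : ∀ x → x · e ≈ x
  ·-identityʳ x = chains⊨⇒⊨ {var 0 ·ᵗ eᵗ} {var 0} (λ L ρ → Chain.·-identityʳ L (ρ 0)) (λ _ → x)

  e∧e≈e : e ∧ e ≈ e
  e∧e≈e = chains⊨⇒⊨ {eᵗ ∧ᵗ eᵗ} {eᵗ} (λ L ρ → Chain.≤-refl L) (λ _ → e)

  ⇔-refl : ∀ x → ((x ⇒ x) ∧ (x ⇒ x)) ∧ e ≈ e
  ⇔-refl x = chains⊨⇒⊨ {((var 0 ⇒ᵗ var 0) ∧ᵗ (var 0 ⇒ᵗ var 0)) ∧ᵗ eᵗ} {eᵗ}
    (λ L ρ → let open Chain L using (y≤x⇒x∧y≈y; ∧-greatest; e≤⇒; ≤-refl) in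
      y≤x⇒x∧y≈y (∧-greatest (e≤⇒ ≤-refl) (e≤⇒ ≤-refl))) (λ _ → x)

_⇔ᵗ_ : Term → Term → Term
s ⇔ᵗ t = (s ⇒ᵗ t) ∧ᵗ (t ⇒ᵗ s)

conditions : List Identity → Term
conditions Γ = ⋀ (map (λ (s , t) → s ⇔ᵗ t) Γ)

Satisfies : ∀ {ℓ} (𝐋 : Algebra ℓ) → (ℕ → Algebra.Carrier 𝐋) → Identity → Set ℓ
Satisfies 𝐋 ρ (s , t) = eval 𝐋 ρ s ≈ eval 𝐋 ρ t
  where open Algebra 𝐋

module _ {ℓ} (𝐁 : Algebra ℓ) (𝐁∈ : 𝐁 ∈ SCIRL) where
  open Algebra 𝐁
  open IsEquivalence isEquivalence renaming (refl to ≈-refl; sym to ≈-sym; trans to ≈-trans)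

  conditions≈e : ∀ {β Γ} → All (Satisfies 𝐁 β) Γ → eval 𝐁 β (conditions Γ) ≈ e
  conditions≈e []       = ≈-refl
  conditions≈e (p ∷ ps) = ≈-trans
    (∧-cong (∧-cong (⇒-cong p ≈-refl) (⇒-cong ≈-refl p)) (conditions≈e ps)) (⇔-refl 𝐁 𝐁∈ _)

module _ {ℓ : Level} where
  private module 𝒰 = Chain (𝐔-isChain {ℓ})

  ⋀≤e : ∀ (v : ℕ → U ℓ) ts → eval 𝐔 v (⋀ ts) 𝒰.≤ 𝐞
  ⋀≤e v []       = 𝒰.≤-refl
  ⋀≤e v (t ∷ ts) = 𝒰.≤-trans (𝒰.x∧y≤y _ _) (⋀≤e v ts)

  e≤conditions⇒satisfies : ∀ {v : ℕ → U ℓ} Γ → 𝐞 𝒰.≤ eval 𝐔 v (conditions Γ) → All (Satisfies 𝐔 v) Γ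
  e≤conditions⇒satisfies []      p = []
  e≤conditions⇒satisfies (_ ∷ Γ) p =
    let q = 𝒰.≤-trans p (𝒰.x∧y≤x _ _) in
    𝒰.≤-antisym (𝒰.e≤⇒⁻ (𝒰.≤-trans q (𝒰.x∧y≤x _ _))) (𝒰.e≤⇒⁻ (𝒰.≤-trans q (𝒰.x∧y≤y _ _)))
      ∷ e≤conditions⇒satisfies Γ (𝒰.≤-trans p (𝒰.x∧y≤y _ _))

  satisfies-φ : ∀ {φ : U ℓ → U ℓ} → NearEmbedding φ → ∀ {v Γ} →
    All (Satisfies 𝐔 v) Γ → All (Satisfies 𝐔 (λ i → φ (v i))) Γ
  satisfies-φ {φ} F {v} = All.map λ { {s , t} p → trans (sym (eval-φ v s)) (trans (cong φ p) (eval-φ v t)) }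
    where open NearEmbedding F

Link : Set
Link = ℕ × ℕ

-- The substitution for the variables of the interpolant. Past the end of the list it yields `eᵗ`,
-- whose value is shared by all three algebras.
linkTerm : (Link → ℕ) → List Link → ℕ → Term
linkTerm f []      _       = eᵗ
linkTerm f (d ∷ _) zero    = var (f d)
linkTerm f (_ ∷ Δ) (suc n) = linkTerm f Δ n

linkBound : (Link → ℕ) → List Link → ℕ
linkBound f = foldr (λ d b → suc (f d) ℕ.⊔ b) 0

bound-linkTerm : ∀ f Δ n → bound (linkTerm f Δ n) ℕ.≤ linkBound f Δ
bound-linkTerm f []      n       = ℕ.z≤n
bound-linkTerm f (d ∷ Δ) zero    = ℕ.m≤m⊔n (suc (f d)) (linkBound f Δ)
bound-linkTerm f (d ∷ Δ) (suc n) = ℕ.≤-trans (bound-linkTerm f Δ n) (ℕ.m≤n⊔m (suc (f d)) _)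

module _ {ℓ} {X Y Z : Algebra ℓ} {v : ℕ → Algebra.Carrier X} {w : ℕ → Algebra.Carrier Y}
  {φ : Algebra.Carrier X → Algebra.Carrier Z} {ψ : Algebra.Carrier Y → Algebra.Carrier Z} where

  linked : ∀ Δ →
    (∀ {n} → n ℕ.< length Δ → φ (eval X v (linkTerm proj₁ Δ n)) ≡ ψ (eval Y w (linkTerm proj₂ Δ n))) →
    All (λ (i , j) → φ (v i) ≡ ψ (w j)) Δ
  linked []      p = []
  linked (d ∷ Δ) p = p (ℕ.s≤s ℕ.z≤n) ∷ linked Δ λ n<m → p (ℕ.s≤s n<m)

-- W is an interpolant: it follows from ΓC, and, read in the variables shared with B,
-- it forces every model of ΓB to be amalgamable with a model of ΓC.
module Interpolation {ℓ : Level} (ΓC : List Identity) (Δ : List Link) where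
  private
    module 𝒰 = Chain (𝐔-isChain {ℓ})
    gC = conditions ΓC
    m = length Δ
    NC = bound gC ℕ.⊔ linkBound proj₂ Δ
    θ = linkTerm proj₂ Δ
    module π (w : ℕ → U ℓ) = Collapse (eval 𝐔 w gC) (≤⇒≼ (⋀≤e w (map (λ (s , t) → s ⇔ᵗ t) ΓC)))

  -- No test of whether `w` satisfies `ΓC` is made: dividing by the filter generated by the value of
  -- `gC` makes the facts true.
  model : (ℕ → U ℓ) → ℕ → U ℓ
  model w i = π.π w (w i)

  shared : (ℕ → U ℓ) → ℕ → U ℓ
  shared w n = eval 𝐔 (model w) (θ n)

  -- The signature has no constant for the bottom, so the fold starts from one more diagram of a
  -- model.
  W-from : List (ℕ → U ℓ) → Term
  W-from = foldr (λ w t → diag m (shared w) ∨ᵗ t) (diag m (shared λ _ → 𝐞))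

  W : Term
  W = W-from (valuations NC NC)

  model-satisfies : ∀ w → All (Satisfies 𝐔 (model w)) ΓC
  model-satisfies w = e≤conditions⇒satisfies ΓC
    (𝒰.≤-reflexive (trans (sym (π.π-h w)) (π.eval-π w w gC)))

  ≤W-from : ∀ {w ws} (v : ℕ → U ℓ) → w ∈ˡ ws → eval 𝐔 v (diag m (shared w)) 𝒰.≤ eval 𝐔 v (W-from ws)
  ≤W-from v (here refl) = 𝒰.x≤x∨y _ _
  ≤W-from v (there p)   = 𝒰.≤-trans (≤W-from v p) (𝒰.y≤x∨y _ _)

  -- In the quotient the model satisfies its own diagram, and an element whose image is at least `e`
  -- lies above the generator, the value of `gC`.
  conditions≤diag : ∀ w → eval 𝐔 w gC 𝒰.≤ eval 𝐔 (λ n → eval 𝐔 w (θ n)) (diag m (shared w))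
  conditions≤diag w = ≼⇒≤ (π.e≼π⇒h≼ w _ (≤⇒≼ (subst (𝐞 𝒰.≤_)
    (sym (trans (π.eval-π w (λ n → eval 𝐔 w (θ n)) (diag m (shared w)))
                (eval-cong 𝐔 (λ n → π.eval-π w w (θ n)) (diag m (shared w)))))
    (diag-self m (shared w)))))

  conditions⇒W : ∀ {𝐋 : Algebra ℓ} → IsChain 𝐋 → 𝐋 ⊨ (gC ∧ᵗ sub θ W , gC)
  conditions⇒W L ρ = transfer (gC ∧ᵗ sub θ W) gC
    (ℕ.⊔-lub gC≤NC (bound-sub (λ n → ℕ.≤-trans (bound-linkTerm proj₂ Δ n) (ℕ.m≤n⊔m (bound gC) _)) W)) gC≤NC
    (subst (eval 𝐔 w gC 𝒰.≤_) (sym (eval-sub 𝐔 θ w W))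
      (𝒰.≤-trans (conditions≤diag w) (≤W-from (λ n → eval 𝐔 w (θ n)) w∈)))
    where
    represented = represent L NC ρ
    w = proj₁ represented
    w∈ = proj₁ (proj₂ represented)
    transfer = proj₂ (proj₂ represented)
    gC≤NC : bound gC ℕ.≤ NC
    gC≤NC = ℕ.m≤m⊔n (bound gC) _

  -- By totality a join is one of its arguments, so a join above `e` has a disjunct above `e`.
  e≤W-from⁻ : ∀ {p : ℕ → U ℓ} ws → 𝐞 𝒰.≤ eval 𝐔 p (W-from ws) →
    Σ[ w ∈ (ℕ → U ℓ) ] 𝐞 𝒰.≤ eval 𝐔 p (diag m (shared w))
  e≤W-from⁻ []       q = _ , q
  e≤W-from⁻ {p} (w ∷ ws) q = choose (𝒰.total (eval 𝐔 p (diag m (shared w))) (eval 𝐔 p (W-from ws)))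
    where
    choose : eval 𝐔 p (diag m (shared w)) 𝒰.≤ eval 𝐔 p (W-from ws) ⊎
             eval 𝐔 p (W-from ws) 𝒰.≤ eval 𝐔 p (diag m (shared w)) → _
    choose (inj₁ r) = e≤W-from⁻ ws (𝒰.≤-trans q (𝒰.≤-reflexive (𝒰.x≤y⇒x∨y≈y r)))
    choose (inj₂ r) = w , 𝒰.≤-trans q (𝒰.≤-reflexive (𝒰.y≤x⇒x∨y≈x r))

  e≤W⇒amalgam : ∀ {p : ℕ → U ℓ} → 𝐞 𝒰.≤ eval 𝐔 p W → Σ[ w ∈ (ℕ → U ℓ) ] Amalgam m p (shared w)
  e≤W⇒amalgam {p} q = let w , r = e≤W-from⁻ (valuations NC NC) q in
    w , amalgam m (shared w) p (diag⇒specialises r)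

-- Conservativity of the amalgam over one factor

module Conservativity {ℓ} {𝐀 𝐁 𝐂 : Algebra ℓ} (𝐁∈ : 𝐁 ∈ SCIRL) (𝐂∈ : 𝐂 ∈ SCIRL)
  (i₁ : Embedding 𝐀 𝐁) (i₂ : Embedding 𝐀 𝐂) where
  private
    module A = Algebra 𝐀
    module B = Algebra 𝐁
    module C = Algebra 𝐂
    module I₁ = Embedding i₁
    module I₂ = Embedding i₂
    module ≈B = IsEquivalence B.isEquivalence
    module ≈C = IsEquivalence C.isEquivalence
    module 𝒰 = Chain (𝐔-isChain {ℓ})

  Linked : (ℕ → B.Carrier) → (ℕ → C.Carrier) → Link → Set ℓ
  Linked β γ (i , j) = Σ[ a ∈ A.Carrier ] I₁.⟦ a ⟧ B.≈ β i × I₂.⟦ a ⟧ C.≈ γ j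

  module _ {β : ℕ → B.Carrier} {γ : ℕ → C.Carrier} where
    linkValue : ∀ {Δ} → All (Linked β γ) Δ → ℕ → A.Carrier
    linkValue []             _       = A.e
    linkValue ((a , _) ∷ _)  zero    = a
    linkValue (_       ∷ ls) (suc n) = linkValue ls n

    linkValue₁ : ∀ {Δ} (ls : All (Linked β γ) Δ) n → I₁.⟦ linkValue ls n ⟧ B.≈ eval 𝐁 β (linkTerm proj₁ Δ n)
    linkValue₁ []                _       = I₁.e-homo
    linkValue₁ ((_ , p , _) ∷ _) zero    = p
    linkValue₁ (_ ∷ ls)          (suc n) = linkValue₁ ls n

    linkValue₂ : ∀ {Δ} (ls : All (Linked β γ) Δ) n → I₂.⟦ linkValue ls n ⟧ C.≈ eval 𝐂 γ (linkTerm proj₂ Δ n)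
    linkValue₂ []                _       = I₂.e-homo
    linkValue₂ ((_ , _ , p) ∷ _) zero    = p
    linkValue₂ (_ ∷ ls)          (suc n) = linkValue₂ ls n

  module _ {β : ℕ → B.Carrier} {γ : ℕ → C.Carrier} {ΓB ΓC : List Identity} {Δ : List Link}
    (ΓB-true : All (Satisfies 𝐁 β) ΓB) (ΓC-true : All (Satisfies 𝐂 γ) ΓC) (links : All (Linked β γ) Δ)
    (k l : ℕ)
    (entails : ∀ (v w : ℕ → U ℓ) → All (Satisfies 𝐔 v) ΓB → All (Satisfies 𝐔 w) ΓC →
               All (λ (i , j) → v i ≡ w j) Δ → v k ≡ v l) where
    private
      open Interpolation {ℓ} ΓC Δ
      θ₁ = linkTerm proj₁ Δ
      θ₂ = linkTerm proj₂ Δ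
      α = linkValue links
      gB = conditions ΓB
      gC = conditions ΓC
      -- In `𝐁` only `e ≤ W` will be known; the meet with `eᵗ` makes this factor equal to `e`.
      G = gB ∧ᵗ (eᵗ ∧ᵗ sub θ₁ W)

      W-in-C : C.e C.∧ eval 𝐂 γ (sub θ₂ W) C.≈ C.e
      W-in-C = ≈C.trans (C.∧-cong (≈C.sym gC≈e) ≈C.refl)
        (≈C.trans (chains⊨⇒⊨ 𝐂 𝐂∈ {gC ∧ᵗ sub θ₂ W} {gC} conditions⇒W γ) gC≈e)
        where gC≈e = conditions≈e 𝐂 𝐂∈ ΓC-true

      transport₂ : I₂.⟦ eval 𝐀 α W ⟧ C.≈ eval 𝐂 γ (sub θ₂ W)
      transport₂ = ≈C.trans (eval-embedding i₂ α W) (≈C.trans (eval-cong 𝐂 (linkValue₂ links) W)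
        (≈C.reflexive (sym (eval-sub 𝐂 θ₂ γ W))))

      transport₁ : I₁.⟦ eval 𝐀 α W ⟧ B.≈ eval 𝐁 β (sub θ₁ W)
      transport₁ = ≈B.trans (eval-embedding i₁ α W) (≈B.trans (eval-cong 𝐁 (linkValue₁ links) W)
        (≈B.reflexive (sym (eval-sub 𝐁 θ₁ β W))))

      -- `W` is evaluated at elements coming from `𝐀`, and `i₂` is injective, so the equation is
      -- reflected from `𝐂`.
      W-in-A : A.e A.∧ eval 𝐀 α W A.≈ A.e
      W-in-A = I₂.injective (≈C.trans (I₂.∧-homo _ _)
        (≈C.trans (C.∧-cong I₂.e-homo transport₂) (≈C.trans W-in-C (≈C.sym I₂.e-homo))))

      W-in-B : B.e B.∧ eval 𝐁 β (sub θ₁ W) B.≈ B.e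
      W-in-B = ≈B.trans (B.∧-cong (≈B.sym I₁.e-homo) (≈B.sym transport₁))
        (≈B.trans (≈B.sym (I₁.∧-homo _ _)) (≈B.trans (I₁.cong W-in-A) I₁.e-homo))

      G≈e : eval 𝐁 β G B.≈ B.e
      G≈e = ≈B.trans (B.∧-cong (conditions≈e 𝐁 𝐁∈ ΓB-true) W-in-B) (e∧e≈e 𝐁 𝐁∈)

      -- In the quotient by the filter of `G`, the valuation `v′` satisfies `ΓB` and puts `W` above
      -- `e`, so it amalgamates with a model of `ΓC`. There `entails` applies, `φ` reflects the
      -- resulting equality, and `π-kernel` lifts it from the quotient.
      G-identifies : 𝐔 {ℓ} ⊨ (var k ·ᵗ G , var l ·ᵗ G)
      G-identifies v = π-kernel (φ-injective (entails (λ i → φ (v′ i)) (λ j → ψ (model w j))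
          (satisfies-φ φ-near (e≤conditions⇒satisfies ΓB (𝒰.≤-trans e≤G (𝒰.x∧y≤x _ _))))
          (satisfies-φ ψ-near (model-satisfies w))
          (linked {X = 𝐔} {𝐔} {𝐔} {v′} {model w} {φ} {ψ} Δ agree)))
        where
        open Collapse (eval 𝐔 v G) (≤⇒≼ (𝒰.≤-trans (𝒰.x∧y≤x _ _) (⋀≤e v (map (λ (s , t) → s ⇔ᵗ t) ΓB))))
        v′ : ℕ → U ℓ
        v′ i = π (v i)
        e≤G : 𝐞 𝒰.≤ eval 𝐔 v′ G
        e≤G = 𝒰.≤-reflexive (trans (sym π-h) (eval-π v G))
        e≤W : 𝐞 𝒰.≤ eval 𝐔 (λ n → eval 𝐔 v′ (θ₁ n)) W
        e≤W = subst (𝐞 𝒰.≤_) (eval-sub 𝐔 θ₁ v′ W)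
          (𝒰.≤-trans e≤G (𝒰.≤-trans (𝒰.x∧y≤y _ _) (𝒰.x∧y≤y _ _)))
        w = proj₁ (e≤W⇒amalgam e≤W)
        open Amalgam (proj₂ (e≤W⇒amalgam e≤W))

    conservative : β k B.≈ β l
    conservative = ≈B.trans (absorb k) (≈B.trans (𝐔⊨⇒⊨ 𝐁 𝐁∈ {var k ·ᵗ G} {var l ·ᵗ G} G-identifies β) (≈B.sym (absorb l)))
      where
      absorb : ∀ n → β n B.≈ β n B.· eval 𝐁 β G
      absorb n = ≈B.sym (≈B.trans (B.·-cong ≈B.refl G≈e) (·-identityʳ 𝐁 𝐁∈ (β n)))

-- The pushout

-- ℕ × ℕ is enumerated by walking along antidiagonals.
advance : ℕ × ℕ → ℕ × ℕ
advance (a , zero)  = 0 , suc a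
advance (a , suc b) = suc a , b

decode : ℕ → ℕ × ℕ
decode zero    = 0 , 0
decode (suc n) = advance (decode n)

encode : ∀ a b → Σ[ n ∈ ℕ ] decode n ≡ (a , b)
encode a b = walk a b (start (a ℕ.+ b))
  where
  walk : ∀ a b → Σ[ n ∈ ℕ ] decode n ≡ (0 , a ℕ.+ b) → Σ[ n ∈ ℕ ] decode n ≡ (a , b)
  walk zero    b p = p
  walk (suc a) b p = let n , q = walk a (suc b) (subst (λ d → Σ[ n ∈ ℕ ] decode n ≡ (0 , d)) (sym (ℕ.+-suc a b)) p)
                     in suc n , cong advance q
  start : ∀ d → Σ[ n ∈ ℕ ] decode n ≡ (0 , d)
  start zero    = 0 , refl
  start (suc d) = let n , q = walk d 0 (subst (λ d → Σ[ n ∈ ℕ ] decode n ≡ (0 , d)) (sym (ℕ.+-identityʳ d)) (start d))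
                  in suc n , cong advance q

code : ℕ → ℕ → ℕ
code a b = proj₁ (encode a b)

module _ {a} {A : Set a} where

  weave : (ℕ → ℕ → A) → ℕ → A
  weave f k = let n , i = decode k in f n i

  weave-code : ∀ f n i → weave f (code n i) ≡ f n i
  weave-code f n i = cong (λ (n , i) → f n i) (proj₂ (encode n i))

  either : (ℕ → A) → (ℕ → A) → ℕ → ℕ → A
  either f g zero    = f
  either f g (suc _) = g

data Operation : Set where
  meet join product residual : Operation

data Tm {a} (X : Set a) : Set a where
  leaf : X → Tm X
  node : Operation → Tm X → Tm X → Tm X
  unit : Tm X

module _ {ℓ} (𝐌 : Algebra ℓ) where
  open Algebra 𝐌

  operation : Operation → Op₂ Carrier
  operation meet     = _∧_
  operation join     = _∨_
  operation product  = _·_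
  operation residual = _⇒_

  evalTm : ∀ {a} {X : Set a} → (X → Carrier) → Tm X → Carrier
  evalTm f (leaf x)     = f x
  evalTm f (node o s t) = operation o (evalTm f s) (evalTm f t)
  evalTm f unit         = e

mapTm : ∀ {a b} {X : Set a} {Y : Set b} → (X → Y) → Tm X → Tm Y
mapTm f (leaf x)     = leaf (f x)
mapTm f (node o s t) = node o (mapTm f s) (mapTm f t)
mapTm f unit         = unit

inst : ∀ {a} {X : Set a} → (ℕ → Tm X) → Term → Tm X
inst τ (var i)  = τ i
inst τ (s ∧ᵗ t) = node meet (inst τ s) (inst τ t)
inst τ (s ∨ᵗ t) = node join (inst τ s) (inst τ t)
inst τ (s ·ᵗ t) = node product (inst τ s) (inst τ t)
inst τ (s ⇒ᵗ t) = node residual (inst τ s) (inst τ t)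
inst τ eᵗ       = unit

module _ {a b} {X : Set a} {Y : Set b} where

  mapTm-cong : {f g : X → Y} → (∀ x → f x ≡ g x) → ∀ t → mapTm f t ≡ mapTm g t
  mapTm-cong p (leaf x)     = cong leaf (p x)
  mapTm-cong p (node o s t) = cong₂ (node o) (mapTm-cong p s) (mapTm-cong p t)
  mapTm-cong p unit         = refl

  mapTm-∘ : ∀ {c} {Z : Set c} (f : Y → Z) (g : X → Y) t → mapTm f (mapTm g t) ≡ mapTm (f ∘ g) t
  mapTm-∘ f g (leaf x)     = refl
  mapTm-∘ f g (node o s t) = cong₂ (node o) (mapTm-∘ f g s) (mapTm-∘ f g t)
  mapTm-∘ f g unit         = refl

  evalTm-mapTm : ∀ {ℓ} (𝐌 : Algebra ℓ) (f : Y → Algebra.Carrier 𝐌) (g : X → Y) t →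
    evalTm 𝐌 f (mapTm g t) ≡ evalTm 𝐌 (f ∘ g) t
  evalTm-mapTm 𝐌 f g (leaf x)     = refl
  evalTm-mapTm 𝐌 f g (node o s t) = cong₂ (operation 𝐌 o) (evalTm-mapTm 𝐌 f g s) (evalTm-mapTm 𝐌 f g t)
  evalTm-mapTm 𝐌 f g unit         = refl

  mapTm-inst : ∀ {f : X → Y} {σ τ} → (∀ i → mapTm f (τ i) ≡ σ i) → ∀ t → mapTm f (inst τ t) ≡ inst σ t
  mapTm-inst p (var i)  = p i
  mapTm-inst p (s ∧ᵗ t) = cong₂ (node meet) (mapTm-inst p s) (mapTm-inst p t)
  mapTm-inst p (s ∨ᵗ t) = cong₂ (node join) (mapTm-inst p s) (mapTm-inst p t)
  mapTm-inst p (s ·ᵗ t) = cong₂ (node product) (mapTm-inst p s) (mapTm-inst p t)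
  mapTm-inst p (s ⇒ᵗ t) = cong₂ (node residual) (mapTm-inst p s) (mapTm-inst p t)
  mapTm-inst p eᵗ       = refl

evalTm-cong : ∀ {ℓ a} (𝐌 : Algebra ℓ) {X : Set a} {f g : X → Algebra.Carrier 𝐌} →
  (∀ x → f x ≡ g x) → ∀ t → evalTm 𝐌 f t ≡ evalTm 𝐌 g t
evalTm-cong 𝐌 p (leaf x)     = p x
evalTm-cong 𝐌 p (node o s t) = cong₂ (operation 𝐌 o) (evalTm-cong 𝐌 p s) (evalTm-cong 𝐌 p t)
evalTm-cong 𝐌 p unit         = refl

evalTm-inst : ∀ {ℓ a} (𝐌 : Algebra ℓ) {X : Set a} (f : X → Algebra.Carrier 𝐌) τ t →
  evalTm 𝐌 f (inst τ t) ≡ eval 𝐌 (λ i → evalTm 𝐌 f (τ i)) t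
evalTm-inst 𝐌 f τ (var i)  = refl
evalTm-inst 𝐌 f τ (s ∧ᵗ t) = cong₂ (Algebra._∧_ 𝐌) (evalTm-inst 𝐌 f τ s) (evalTm-inst 𝐌 f τ t)
evalTm-inst 𝐌 f τ (s ∨ᵗ t) = cong₂ (Algebra._∨_ 𝐌) (evalTm-inst 𝐌 f τ s) (evalTm-inst 𝐌 f τ t)
evalTm-inst 𝐌 f τ (s ·ᵗ t) = cong₂ (Algebra._·_ 𝐌) (evalTm-inst 𝐌 f τ s) (evalTm-inst 𝐌 f τ t)
evalTm-inst 𝐌 f τ (s ⇒ᵗ t) = cong₂ (Algebra._⇒_ 𝐌) (evalTm-inst 𝐌 f τ s) (evalTm-inst 𝐌 f τ t)
evalTm-inst 𝐌 f τ eᵗ       = refl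

-- The pushout of B and C over A: terms over B ⊎ C, two of which are equal when
-- finitely many true facts force them to be equal under all valuations in the
-- universal chain.  Equality in B ⊎ C being undecidable, valuations are defined
-- on names (natural numbers) for the finitely many elements involved.
module Pushout {ℓ} {𝐀 𝐁 𝐂 : Algebra ℓ} (𝐁∈ : 𝐁 ∈ SCIRL) (𝐂∈ : 𝐂 ∈ SCIRL)
  (i₁ : Embedding 𝐀 𝐁) (i₂ : Embedding 𝐀 𝐂) where
  private
    module A = Algebra 𝐀
    module B = Algebra 𝐁
    module C = Algebra 𝐂
    module I₁ = Embedding i₁
    module I₂ = Embedding i₂
    module ≈B = IsEquivalence B.isEquivalence
    module ≈C = IsEquivalence C.isEquivalence

  data Fact (β : ℕ → B.Carrier) (γ : ℕ → C.Carrier) : Set ℓ where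
    inB  : ∀ s t → Satisfies 𝐁 β (s , t) → Fact β γ
    inC  : ∀ s t → Satisfies 𝐂 γ (s , t) → Fact β γ
    link : ∀ i j a → I₁.⟦ a ⟧ B.≈ β i → I₂.⟦ a ⟧ C.≈ γ j → Fact β γ

  Holds : ∀ {β γ} (v w : ℕ → U ℓ) → Fact β γ → Set ℓ
  Holds v w (inB s t _)      = Satisfies 𝐔 v (s , t)
  Holds v w (inC s t _)      = Satisfies 𝐔 w (s , t)
  Holds v w (link i j _ _ _) = v i ≡ w j

  denote : (ℕ → B.Carrier) → (ℕ → C.Carrier) → Tm (ℕ ⊎ ℕ) → Tm (B.Carrier ⊎ C.Carrier)
  denote β γ = mapTm (Sum.map β γ)

  value : (v w : ℕ → U ℓ) → Tm (ℕ ⊎ ℕ) → U ℓ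
  value v w = evalTm 𝐔 [ v , w ]′

  infix 4 _≈_
  record _≈_ (s t : Tm (B.Carrier ⊎ C.Carrier)) : Set ℓ where
    constructor proves
    field
      {β}     : ℕ → B.Carrier
      {γ}     : ℕ → C.Carrier
      {s₀ t₀} : Tm (ℕ ⊎ ℕ)
      s-name  : denote β γ s₀ ≡ s
      t-name  : denote β γ t₀ ≡ t
      facts   : List (Fact β γ)
      entails : ∀ v w → All (Holds v w) facts → value v w s₀ ≡ value v w t₀

  module Rename {β β′ : ℕ → B.Carrier} {γ γ′ : ℕ → C.Carrier} (r : ℕ → ℕ)
    (β-r : ∀ i → β′ (r i) ≡ β i) (γ-r : ∀ i → γ′ (r i) ≡ γ i) where

    renameᵗ : Term → Term
    renameᵗ = sub (λ i → var (r i))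

    satisfies-rename : ∀ {𝐋 : Algebra ℓ} {ρ ρ′} → (∀ i → ρ′ (r i) ≡ ρ i) → ∀ s t →
      Satisfies 𝐋 ρ (s , t) → Satisfies 𝐋 ρ′ (renameᵗ s , renameᵗ t)
    satisfies-rename {𝐋} {ρ} {ρ′} p s t q = ≈.trans (renamed s) (≈.trans q (≈.sym (renamed t)))
      where
      module ≈ = IsEquivalence (Algebra.isEquivalence 𝐋)
      renamed : ∀ u → Algebra._≈_ 𝐋 (eval 𝐋 ρ′ (renameᵗ u)) (eval 𝐋 ρ u)
      renamed u = ≈.trans (≈.reflexive (eval-sub 𝐋 (λ i → var (r i)) ρ′ u)) (eval-cong 𝐋 (λ i → ≈.reflexive (p i)) u)

    renameFact : Fact β γ → Fact β′ γ′
    renameFact (inB s t p) = inB (renameᵗ s) (renameᵗ t) (satisfies-rename {𝐁} β-r s t p)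
    renameFact (inC s t p) = inC (renameᵗ s) (renameᵗ t) (satisfies-rename {𝐂} γ-r s t p)
    renameFact (link i j a p q) = link (r i) (r j) a
      (≈B.trans p (≈B.reflexive (sym (β-r i)))) (≈C.trans q (≈C.reflexive (sym (γ-r j))))

    holds-rename : ∀ {v w} φ → Holds v w (renameFact φ) → Holds (v ∘ r) (w ∘ r) φ
    holds-rename {v} (inB s t _) p =
      trans (sym (eval-sub 𝐔 (λ i → var (r i)) v s)) (trans p (eval-sub 𝐔 (λ i → var (r i)) v t))
    holds-rename {_} {w} (inC s t _) p =
      trans (sym (eval-sub 𝐔 (λ i → var (r i)) w s)) (trans p (eval-sub 𝐔 (λ i → var (r i)) w t))
    holds-rename (link _ _ _ _ _) p = p

    renameTm : Tm (ℕ ⊎ ℕ) → Tm (ℕ ⊎ ℕ)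
    renameTm = mapTm (Sum.map r r)

    denote-rename : ∀ t → denote β′ γ′ (renameTm t) ≡ denote β γ t
    denote-rename t = trans (mapTm-∘ _ _ t)
      (mapTm-cong (λ { (inj₁ i) → cong inj₁ (β-r i) ; (inj₂ j) → cong inj₂ (γ-r j) }) t)

    value-rename : ∀ v w t → value v w (renameTm t) ≡ value (v ∘ r) (w ∘ r) t
    value-rename v w t = trans (evalTm-mapTm 𝐔 _ _ t)
      (evalTm-cong 𝐔 (λ { (inj₁ _) → refl ; (inj₂ _) → refl }) t)

    entails-rename : ∀ {facts s t} → (∀ v w → All (Holds v w) facts → value v w s ≡ value v w t) →
      ∀ v w → All (Holds v w) (map renameFact facts) → value v w (renameTm s) ≡ value v w (renameTm t)
    entails-rename {facts} {s} {t} p v w h = trans (value-rename v w s)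
      (trans (p (v ∘ r) (w ∘ r) (All.map (λ {φ} → holds-rename φ) (All.map⁻ h))) (sym (value-rename v w t)))

  -- Two derivations choose their names independently; tagging with 0 and 1 through `code` keeps the
  -- names apart in a common naming.
  module Join (β₁ β₂ : ℕ → B.Carrier) (γ₁ γ₂ : ℕ → C.Carrier) where
    β = weave (either β₁ β₂)
    γ = weave (either γ₁ γ₂)
    module L = Rename {β₁} {β} {γ₁} {γ} (code 0) (weave-code (either β₁ β₂) 0) (weave-code (either γ₁ γ₂) 0)
    module R = Rename {β₂} {β} {γ₂} {γ} (code 1) (weave-code (either β₁ β₂) 1) (weave-code (either γ₁ γ₂) 1)

  named : ∀ t → Σ[ β ∈ (ℕ → B.Carrier) ] Σ[ γ ∈ (ℕ → C.Carrier) ] Σ[ t₀ ∈ Tm (ℕ ⊎ ℕ) ] denote β γ t₀ ≡ t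
  named (leaf (inj₁ b)) = (λ _ → b) , (λ _ → C.e) , leaf (inj₁ 0) , refl
  named (leaf (inj₂ c)) = (λ _ → B.e) , (λ _ → c) , leaf (inj₂ 0) , refl
  named unit            = (λ _ → B.e) , (λ _ → C.e) , unit , refl
  named (node o s t) with named s | named t
  ... | β₁ , γ₁ , s₀ , p | β₂ , γ₂ , t₀ , q = J.β , J.γ , node o (J.L.renameTm s₀) (J.R.renameTm t₀)
        , cong₂ (node o) (trans (J.L.denote-rename s₀) p) (trans (J.R.denote-rename t₀) q)
    where module J = Join β₁ β₂ γ₁ γ₂

  -- Different names may denote one element, and valuations do not know this; each pair of matching
  -- leaves contributes a fact that equates them. Transitivity needs this for its middle term, which
  -- is named twice.
  same-denotation : ∀ {β γ} s t → denote β γ s ≡ denote β γ t →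
    Σ[ facts ∈ List (Fact β γ) ] (∀ v w → All (Holds v w) facts → value v w s ≡ value v w t)
  same-denotation {β} {γ} = go
    where
    leafB : ∀ {x y} → leaf {X = B.Carrier ⊎ C.Carrier} (inj₁ x) ≡ leaf (inj₁ y) → x ≡ y
    leafB refl = refl
    leafC : ∀ {x y} → leaf {X = B.Carrier ⊎ C.Carrier} (inj₂ x) ≡ leaf (inj₂ y) → x ≡ y
    leafC refl = refl
    node-injective : ∀ {o o′ s s′ t t′} → node {X = B.Carrier ⊎ C.Carrier} o s t ≡ node o′ s′ t′ →
      o ≡ o′ × s ≡ s′ × t ≡ t′
    node-injective refl = refl , refl , refl
    go : ∀ s t → denote β γ s ≡ denote β γ t →
      Σ[ facts ∈ List (Fact β γ) ] (∀ v w → All (Holds v w) facts → value v w s ≡ value v w t)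
    go (leaf (inj₁ i)) (leaf (inj₁ j)) p =
      [ inB (var i) (var j) (≈B.reflexive (leafB p)) ] , λ { v w (h ∷ []) → h }
    go (leaf (inj₂ i)) (leaf (inj₂ j)) p =
      [ inC (var i) (var j) (≈C.reflexive (leafC p)) ] , λ { v w (h ∷ []) → h }
    go (leaf (inj₁ i)) (leaf (inj₂ j)) ()
    go (leaf (inj₂ i)) (leaf (inj₁ j)) ()
    go (leaf _) (node _ _ _) ()
    go (leaf _) unit ()
    go (node _ _ _) (leaf _) ()
    go (node o s t) (node o′ s′ t′) p with node-injective p
    ... | refl , ps , pt = let f , k = go s s′ ps ; g , l = go t t′ pt in
      f ++ g , λ v w h → cong₂ (operation 𝐔 o) (k v w (All.++⁻ˡ f h)) (l v w (All.++⁻ʳ f h))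
    go (node _ _ _) unit ()
    go unit (leaf _) ()
    go unit (node _ _ _) ()
    go unit unit _ = [] , λ _ _ _ → refl

  ≈-refl : ∀ {t} → t ≈ t
  ≈-refl {t} = let β , γ , t₀ , p = named t in proves p p [] λ _ _ _ → refl

  ≈-sym : ∀ {s t} → s ≈ t → t ≈ s
  ≈-sym (proves p q f k) = proves q p f λ v w h → sym (k v w h)

  ≈-trans : ∀ {s t u} → s ≈ t → t ≈ u → s ≈ u
  ≈-trans (proves {β₁} {γ₁} {s₀} {t₁} p q f k) (proves {β₂} {γ₂} {t₂} {u₀} p′ q′ g l) =
    proves (trans (J.L.denote-rename s₀) p) (trans (J.R.denote-rename u₀) q′)
      (map J.L.renameFact f ++ map J.R.renameFact g ++ bridge)
      λ v w h → trans (J.L.entails-rename {f} {s₀} {t₁} k v w (All.++⁻ˡ (map J.L.renameFact f) h))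
        (trans (bridge-entails v w (All.++⁻ʳ (map J.R.renameFact g) (All.++⁻ʳ (map J.L.renameFact f) h)))
          (J.R.entails-rename {g} {t₂} {u₀} l v w (All.++⁻ˡ (map J.R.renameFact g) (All.++⁻ʳ (map J.L.renameFact f) h))))
    where
    module J = Join β₁ β₂ γ₁ γ₂
    bridging = same-denotation (J.L.renameTm t₁) (J.R.renameTm t₂)
      (trans (J.L.denote-rename t₁) (trans q (trans (sym p′) (sym (J.R.denote-rename t₂)))))
    bridge = proj₁ bridging
    bridge-entails = proj₂ bridging

  node-cong : ∀ o {s s′ t t′} → s ≈ s′ → t ≈ t′ → node o s t ≈ node o s′ t′
  node-cong o (proves {β₁} {γ₁} {s₀} {s₁} p q f k) (proves {β₂} {γ₂} {t₀} {t₁} p′ q′ g l) =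
    proves {s₀ = node o (J.L.renameTm s₀) (J.R.renameTm t₀)} {node o (J.L.renameTm s₁) (J.R.renameTm t₁)}
      (cong₂ (node o) (trans (J.L.denote-rename s₀) p) (trans (J.R.denote-rename t₀) p′))
      (cong₂ (node o) (trans (J.L.denote-rename s₁) q) (trans (J.R.denote-rename t₁) q′))
      (map J.L.renameFact f ++ map J.R.renameFact g)
      λ v w h → cong₂ (operation 𝐔 o)
        (J.L.entails-rename {f} {s₀} {s₁} k v w (All.++⁻ˡ (map J.L.renameFact f) h))
        (J.R.entails-rename {g} {t₀} {t₁} l v w (All.++⁻ʳ (map J.L.renameFact f) h))
    where module J = Join β₁ β₂ γ₁ γ₂

  𝐃 : Algebra ℓ
  𝐃 = record
    { Carrier = Tm (B.Carrier ⊎ C.Carrier) ; _≈_ = _≈_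
    ; _∧_ = node meet ; _∨_ = node join ; _·_ = node product ; _⇒_ = node residual ; e = unit
    ; isEquivalence = record { refl = ≈-refl ; sym = ≈-sym ; trans = ≈-trans }
    ; ∧-cong = node-cong meet ; ∨-cong = node-cong join ; ·-cong = node-cong product ; ⇒-cong = node-cong residual }

  eval≡inst : ∀ τ t → eval 𝐃 τ t ≡ inst τ t
  eval≡inst τ (var i)  = refl
  eval≡inst τ (s ∧ᵗ t) = cong₂ (node meet) (eval≡inst τ s) (eval≡inst τ t)
  eval≡inst τ (s ∨ᵗ t) = cong₂ (node join) (eval≡inst τ s) (eval≡inst τ t)
  eval≡inst τ (s ·ᵗ t) = cong₂ (node product) (eval≡inst τ s) (eval≡inst τ t)
  eval≡inst τ (s ⇒ᵗ t) = cong₂ (node residual) (eval≡inst τ s) (eval≡inst τ t)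
  eval≡inst τ eᵗ       = refl

  -- An assignment into `𝐃` consists of infinitely many terms with separate namings, all woven into
  -- one. The list of facts is empty because the identity holds under every valuation.
  𝐔⊨⇒𝐃⊨ : ∀ {s t} → 𝐔 {ℓ} ⊨ (s , t) → 𝐃 ⊨ (s , t)
  𝐔⊨⇒𝐃⊨ {s} {t} p τ = proves (denotes s) (denotes t) []
    λ v w _ → trans (evalTm-inst 𝐔 [ v , w ]′ τ₀ s) (trans (p _) (sym (evalTm-inst 𝐔 [ v , w ]′ τ₀ t)))
    where
    β′ = λ n → proj₁ (named (τ n))
    γ′ = λ n → proj₁ (proj₂ (named (τ n)))
    module N n = Rename {β′ n} {weave β′} {γ′ n} {weave γ′} (code n) (weave-code β′ n) (weave-code γ′ n)
    τ₀ : ℕ → Tm (ℕ ⊎ ℕ)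
    τ₀ n = N.renameTm n (proj₁ (proj₂ (proj₂ (named (τ n)))))
    denotes : ∀ u → denote (weave β′) (weave γ′) (inst τ₀ u) ≡ eval 𝐃 τ u
    denotes u = trans
      (mapTm-inst (λ n → trans (N.denote-rename n _) (proj₂ (proj₂ (proj₂ (named (τ n)))))) u)
      (sym (eval≡inst τ u))

  -- `𝐔` itself belongs to the generating class, at the level of the given algebras thanks to the
  -- level parameter of `U`.
  𝐃∈ : 𝐃 ∈ SCIRL
  𝐃∈ E K⊆ {s , t} i∈ = 𝐔⊨⇒𝐃⊨ {s} {t} (K⊆ 𝐔-isChain i∈)

  equationB : ∀ β s t → Satisfies 𝐁 β (s , t) →
    inst (λ i → leaf (inj₁ (β i))) s ≈ inst (λ i → leaf (inj₁ (β i))) t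
  equationB β s t p = proves {β = β} {λ _ → C.e} {inst (leaf ∘ inj₁) s} {inst (leaf ∘ inj₁) t}
    (mapTm-inst (λ _ → refl) s) (mapTm-inst (λ _ → refl) t) [ inB s t p ]
    λ { v w (h ∷ []) → trans (evalTm-inst 𝐔 _ _ s) (trans h (sym (evalTm-inst 𝐔 _ _ t))) }

  equationC : ∀ γ s t → Satisfies 𝐂 γ (s , t) →
    inst (λ i → leaf (inj₂ (γ i))) s ≈ inst (λ i → leaf (inj₂ (γ i))) t
  equationC γ s t p = proves {β = λ _ → B.e} {γ} {inst (leaf ∘ inj₂) s} {inst (leaf ∘ inj₂) t}
    (mapTm-inst (λ _ → refl) s) (mapTm-inst (λ _ → refl) t) [ inC s t p ]
    λ { v w (h ∷ []) → trans (evalTm-inst 𝐔 _ _ s) (trans h (sym (evalTm-inst 𝐔 _ _ t))) }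

  record Classified {β γ} (facts : List (Fact β γ)) : Set ℓ where
    field
      {ΓB ΓC} : List Identity
      {Δ}     : List Link
      ΓB-true : All (Satisfies 𝐁 β) ΓB
      ΓC-true : All (Satisfies 𝐂 γ) ΓC
      links   : All (λ (i , j) → Σ[ a ∈ A.Carrier ] I₁.⟦ a ⟧ B.≈ β i × I₂.⟦ a ⟧ C.≈ γ j) Δ
      holds   : ∀ v w → All (Satisfies 𝐔 v) ΓB → All (Satisfies 𝐔 w) ΓC →
                All (λ (i , j) → v i ≡ w j) Δ → All (Holds v w) facts

  classify : ∀ {β γ} (facts : List (Fact β γ)) → Classified facts
  classify [] = record { ΓB = [] ; ΓC = [] ; Δ = [] ; ΓB-true = [] ; ΓC-true = [] ; links = [] ; holds = λ _ _ _ _ _ → [] }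
  classify (inB s t p ∷ fs) = record
    { ΓB = (s , t) ∷ ΓB ; ΓB-true = p ∷ ΓB-true ; ΓC-true = ΓC-true ; links = links
    ; holds = λ { v w (h ∷ hB) hC hΔ → h ∷ holds v w hB hC hΔ } }
    where open Classified (classify fs)
  classify (inC s t p ∷ fs) = record
    { ΓC = (s , t) ∷ ΓC ; ΓB-true = ΓB-true ; ΓC-true = p ∷ ΓC-true ; links = links
    ; holds = λ { v w hB (h ∷ hC) hΔ → h ∷ holds v w hB hC hΔ } }
    where open Classified (classify fs)
  classify (link i j a p q ∷ fs) = record
    { Δ = (i , j) ∷ Δ ; ΓB-true = ΓB-true ; ΓC-true = ΓC-true ; links = (a , p , q) ∷ links
    ; holds = λ { v w hB hC (h ∷ hΔ) → h ∷ holds v w hB hC hΔ } }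
    where open Classified (classify fs)

  -- Only a leaf can denote a leaf, so the entailment equates two variables, as `conservative`
  -- demands.
  leafB-injective : ∀ {b b′} → leaf (inj₁ b) ≈ leaf (inj₁ b′) → b B.≈ b′
  leafB-injective (proves {s₀ = leaf (inj₁ k)} {leaf (inj₁ l)} refl refl facts entails) =
    Conservativity.conservative 𝐁∈ 𝐂∈ i₁ i₂ ΓB-true ΓC-true links k l
      λ v w hB hC hΔ → entails v w (holds v w hB hC hΔ)
    where open Classified (classify facts)

  leafC-injective : ∀ {c c′} → leaf (inj₂ c) ≈ leaf (inj₂ c′) → c C.≈ c′
  leafC-injective (proves {s₀ = leaf (inj₂ k)} {leaf (inj₂ l)} refl refl facts entails) =
    Conservativity.conservative 𝐂∈ 𝐁∈ i₂ i₁ ΓC-true ΓB-true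
      (All.map⁺ (All.map (λ (a , p , q) → a , q , p) links)) k l
      λ w v hC hB hΔ → entails v w (holds v w hB hC (All.map sym (All.map⁻ hΔ)))
    where open Classified (classify facts)

  triple : ∀ {a} {X : Set a} → X → X → X → ℕ → X
  triple x y z zero          = x
  triple x y z (suc zero)    = y
  triple x y z (suc (suc _)) = z

  private
    homoB : ∀ o x y → leaf (inj₁ (operation 𝐁 o x y)) ≈ node o (leaf (inj₁ x)) (leaf (inj₁ y))
    homoB meet     x y = equationB (triple x y (x B.∧ y)) (var 2) (var 0 ∧ᵗ var 1) ≈B.refl
    homoB join     x y = equationB (triple x y (x B.∨ y)) (var 2) (var 0 ∨ᵗ var 1) ≈B.refl
    homoB product  x y = equationB (triple x y (x B.· y)) (var 2) (var 0 ·ᵗ var 1) ≈B.refl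
    homoB residual x y = equationB (triple x y (x B.⇒ y)) (var 2) (var 0 ⇒ᵗ var 1) ≈B.refl

    homoC : ∀ o x y → leaf (inj₂ (operation 𝐂 o x y)) ≈ node o (leaf (inj₂ x)) (leaf (inj₂ y))
    homoC meet     x y = equationC (triple x y (x C.∧ y)) (var 2) (var 0 ∧ᵗ var 1) ≈C.refl
    homoC join     x y = equationC (triple x y (x C.∨ y)) (var 2) (var 0 ∨ᵗ var 1) ≈C.refl
    homoC product  x y = equationC (triple x y (x C.· y)) (var 2) (var 0 ·ᵗ var 1) ≈C.refl
    homoC residual x y = equationC (triple x y (x C.⇒ y)) (var 2) (var 0 ⇒ᵗ var 1) ≈C.refl

  j₁ : Embedding 𝐁 𝐃
  j₁ = record
    { ⟦_⟧ = λ b → leaf (inj₁ b)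
    ; isRelMonomorphism = record
      { isHomomorphism = record { cong = λ {x} {y} p → equationB (triple x y y) (var 0) (var 1) p }
      ; injective = leafB-injective }
    ; ∧-homo = homoB meet ; ∨-homo = homoB join ; ·-homo = homoB product ; ⇒-homo = homoB residual
    ; e-homo = equationB (λ _ → B.e) (var 0) eᵗ ≈B.refl }

  j₂ : Embedding 𝐂 𝐃
  j₂ = record
    { ⟦_⟧ = λ c → leaf (inj₂ c)
    ; isRelMonomorphism = record
      { isHomomorphism = record { cong = λ {x} {y} p → equationC (triple x y y) (var 0) (var 1) p }
      ; injective = leafC-injective }
    ; ∧-homo = homoC meet ; ∨-homo = homoC join ; ·-homo = homoC product ; ⇒-homo = homoC residual
    ; e-homo = equationC (λ _ → C.e) (var 0) eᵗ ≈C.refl }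

  commutes : ∀ a → leaf (inj₁ I₁.⟦ a ⟧) ≈ leaf (inj₂ I₂.⟦ a ⟧)
  commutes a = proves {β = λ _ → I₁.⟦ a ⟧} {λ _ → I₂.⟦ a ⟧} {leaf (inj₁ 0)} {leaf (inj₂ 0)} refl refl
    [ link 0 0 a ≈B.refl ≈C.refl ] λ { v w (h ∷ []) → h }

theorem6p6 : ∀ {ℓ} → AmalgamationProperty {ℓ} SemilinearCommutativeIdempotentResiduatedLattice
theorem6p6 𝐀 𝐁 𝐂 _ 𝐁∈ 𝐂∈ i₁ i₂ = 𝐃 , 𝐃∈ , j₁ , j₂ , commutes
  where open Pushout 𝐁∈ 𝐂∈ i₁ i₂
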